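{- Let $D$ be a connected ribbon with composition $(\alpha_1(D),\dots,\alpha_\ell(D))$, with an odd number of boxes, with $\alpha_1(D)=1$, and not a basic block. Suppose the length $\ell$ of $D$ is odd, and let $k$ and $m$ be the head length and tail length of $D$. Then $\mathfrak{r}_D$ is not $p$-positive in each of the following cases: (a) $\alpha_\ell(D)>1$ and $k$ is even; (b) $\alpha_\ell(D)>1$, $k$ is odd and $m$ is even; (c) $\alpha_\ell(D)=1$ and $k=m$.
   Context: Boxes are indexed $(i,j)$, row $i$ from the top, column $j$ from the left. For a composition $\alpha=(\alpha_1,\dots,\alpha_\ell)$, the connected ribbon $\alpha$ is the set of boxes in which row $i$ has $\alpha_i$ consecutive boxes and, for $i<\ell$, the leftmost box of row $i$ lies directly above the rightmost box of row $i+1$; its length is $\ell$. A marked shifted tableau of it is a filling by letters of $\{1'<1<2'<2<\cdots\}$ with weakly increasing rows and columns, at most one unmarked $k$ per column and at most one $k'$ per row for each $k$; the content $(c_1,c_2,\dots)$ counts entries with unmarked value $i$. $\mathfrak{r}_D=\sum_Tx_1^{c_1}x_2^{c_2}\cdots$ over all such tableaux. $D^t$ is the reflection of $D$ in the main diagonal and $D^\circ$ its $180$-degree rotation. $\triangle_{n,k}$ ($1\le k\le n$) is the ribbon $(1^{k-1},n-k+1)$. The basic blocks of size $n$ are $\triangle_{n,1},\triangle_{n,1}^t,\triangle_{n,3},\triangle_{n,3}^t,\triangle_{n,3}^\circ,(\triangle_{n,3}^t)^\circ$ for $n\ge3$, and $\triangle_{n,1},\triangle_{n,1}^t$ for $n\le2$.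 The head length of $D$ is the smallest index $i$ with $\alpha_i(D)\ge2$. The tail length of $D$ is: if $\alpha_\ell(D)=1$, the smallest index $j$ with $\alpha_{\ell-j+1}(D)\ge2$; otherwise $\alpha_\ell(D)$. A symmetric function is $p$-positive if all its coefficients in the power sum basis are nonnegative. -}

module Defs where

open import Data.Nat.Base using (ℕ; zero; suc; _+_; _*_; _∸_; _≤_; _<_; _≤ᵇ_; _≡ᵇ_; _⊔_; _⊓_; _%_)
open import Data.Bool.Base using (Bool; true; false; _∧_; _∨_; not; if_then_else_)
open import Data.List.Base using (List; []; _∷_; [_]; _++_; map; concatMap; applyUpTo; upTo; foldr; length; replicate; reverse; zip)
open import Data.Nat.ListAction using (sum)
open import Data.Bool.ListAction using (all)
open import Data.List.Relation.Unary.All using (All)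
open import Data.List.Membership.Propositional using (_∈_)
open import Data.Product.Base using (_×_; _,_; ∃; Σ; swap)
open import Data.Integer.Base using (+_)
open import Data.Rational.Base as ℚ using (ℚ; 0ℚ)
open import Function.Bundles using (_⇔_)
open import Relation.Binary.PropositionalEquality using (_≡_)
open import Relation.Nullary using (¬_)

countB : {A : Set} → (A → Bool) → List A → ℕ
countB p [] = 0
countB p (x ∷ xs) = if p x then suc (countB p xs) else countB p xs

Odd : ℕ → Set
Odd n = n % 2 ≡ 1

Even : ℕ → Set
Even n = n % 2 ≡ 0

allLists : ℕ → ℕ → List (List ℕ)
allLists zero K = [ [] ]
allLists (suc len) K = concatMap (λ v → map (v ∷_) (allLists len K)) (applyUpTo suc K)

eqListB : List ℕ → List ℕ → Bool
eqListB [] [] = true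
eqListB (x ∷ xs) (y ∷ ys) = (x ≡ᵇ y) ∧ eqListB xs ys
eqListB _ _ = false

-- Compositions and connected ribbons.
-- A box is (row , column); rows numbered from the top, columns from the left.

Box : Set
Box = ℕ × ℕ

Diagram : Set
Diagram = List Box

IsComposition : List ℕ → Set
IsComposition α = All (1 ≤_) α

-- rows r, r+1, … ; row i occupies the columns s_i, …, s_i + α_i - 1
-- with s_i = 1 + Σ_{j>i} (α_j - 1), so the leftmost box of row i lies
-- directly above the rightmost box of row i+1 (bottom row starts in column 1).
ribbonRows : ℕ → List ℕ → Diagram
ribbonRows r [] = []
ribbonRows r (a ∷ as) =
  map (λ c → (r , suc (sum (map (_∸ 1) as)) + c)) (upTo a) ++ ribbonRows (suc r) as

-- the connected ribbon with composition α (normalised: top row 1, leftmost column 1)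
ribbon : List ℕ → Diagram
ribbon α = ribbonRows 1 α

transposeD : Diagram → Diagram
transposeD = map swap

-- 180-degree rotation (followed by a translation putting it back in the
-- region with rows/columns starting at 1)
rotateD : Diagram → Diagram
rotateD D = map (λ { (i , j) → (suc R ∸ i , suc C ∸ j) }) D
  where
  R = foldr (λ b m → Data.Product.Base.proj₁ b ⊔ m) 0 D
  C = foldr (λ b m → Data.Product.Base.proj₂ b ⊔ m) 0 D

triangle : ℕ → ℕ → Diagram
triangle n k = ribbon (replicate (k ∸ 1) 1 ++ [ suc n ∸ k ])

basicBlocks : ℕ → List Diagram
basicBlocks n@(suc (suc (suc _))) =
  triangle n 1 ∷ transposeD (triangle n 1) ∷
  triangle n 3 ∷ transposeD (triangle n 3) ∷
  rotateD (triangle n 3) ∷ rotateD (transposeD (triangle n 3)) ∷ []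
basicBlocks n = triangle n 1 ∷ transposeD (triangle n 1) ∷ []

SameDiagram : Diagram → Diagram → Set
SameDiagram D E = ∀ b → (b ∈ D) ⇔ (b ∈ E)

-- the ribbon with composition α is a basic block of size |D| = Σ α
-- (all diagrams are normalised to start at row 1 / column 1, so equality
-- of box sets is equality up to translation)
IsBasicBlock : List ℕ → Set
IsBasicBlock α = ∃ λ B → (B ∈ basicBlocks (sum α)) × SameDiagram (ribbon α) B

-- smallest (1-based) index i with α_i ≥ 2 (length α + 1 if there is none,
-- which never happens under the theorem's hypotheses)
headLength : List ℕ → ℕ
headLength [] = 1
headLength (x ∷ xs) = if 2 ≤ᵇ x then 1 else suc (headLength xs)

lastOf : ℕ → List ℕ → ℕ
lastOf x [] = x
lastOf x (y ∷ ys) = lastOf y ys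

tailLength : ℕ → List ℕ → ℕ
tailLength x xs =
  if lastOf x xs ≡ᵇ 1 then headLength (reverse (x ∷ xs)) else lastOf x xs

-- Marked shifted tableaux.
-- Letters 1' < 1 < 2' < 2 < … are coded by natural numbers:
-- k' ↦ 2k-1,  k ↦ 2k.  So the order of letters is the order of codes.

isMarked : ℕ → Bool
isMarked zero = false
isMarked (suc n) = not (isMarked n)

letterValue : ℕ → ℕ
letterValue zero = 0
letterValue (suc zero) = 1
letterValue (suc (suc n)) = suc (letterValue n)

pairOK : Box × ℕ → Box × ℕ → Bool
pairOK ((r1 , c1) , v1) ((r2 , c2) , v2) =
  (if r1 ≡ᵇ r2
     then ((not (c1 ≤ᵇ c2) ∨ (v1 ≤ᵇ v2)) ∧ (not (c2 ≤ᵇ c1) ∨ (v2 ≤ᵇ v1))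
           ∧ not ((v1 ≡ᵇ v2) ∧ isMarked v1))
     else true)
  ∧
  (if c1 ≡ᵇ c2
     then ((not (r1 ≤ᵇ r2) ∨ (v1 ≤ᵇ v2)) ∧ (not (r2 ≤ᵇ r1) ∨ (v2 ≤ᵇ v1))
           ∧ not ((v1 ≡ᵇ v2) ∧ not (isMarked v1)))
     else true)

allPairsOK : List (Box × ℕ) → Bool
allPairsOK [] = true
allPairsOK (e ∷ es) = all (pairOK e) es ∧ allPairsOK es

-- a filling (list of letter codes, parallel to the box list) is a marked shifted tableau
isTableau : Diagram → List ℕ → Bool
isTableau D f = allPairsOK (zip D f)

contentOf : ℕ → List ℕ → List ℕ
contentOf N f = map (λ j → countB (λ v → letterValue v ≡ᵇ j) f) (applyUpTo suc N)

-- coefficient of x_1^{a_1} … x_N^{a_N} in 𝔯_D, where N = length a: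
-- number of marked shifted tableaux of D with letters among 1',1,…,N',N and content a
rCoeff : Diagram → List ℕ → ℕ
rCoeff D a =
  countB (λ f → isTableau D f ∧ eqListB (contentOf (length a) f) a)
         (allLists (length D) (2 * length a))

-- Power sums p_λ = ∏_i (x_1^{λ_i} + x_2^{λ_i} + ⋯)

choices : ℕ → List ℕ → List (List ℕ)
choices p [] = []
choices p (x ∷ xs) =
  (if p ≤ᵇ x then [ (x ∸ p) ∷ xs ] else []) ++ map (x ∷_) (choices p xs)

-- coefficient of x_1^{a_1} … x_N^{a_N} in p_λ
pCoeff : List ℕ → List ℕ → ℕ
pCoeff [] a = if all (_≡ᵇ 0) a then 1 else 0
pCoeff (p ∷ lam) a = sum (map (pCoeff lam) (choices p a))

partsLE : ℕ → ℕ → ℕ → List (List ℕ)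
partsLE _ zero _ = [ [] ]
partsLE zero (suc _) _ = []
partsLE (suc fuel) r@(suc _) m =
  concatMap (λ k → map (k ∷_) (partsLE fuel (r ∸ k) k)) (applyUpTo suc (m ⊓ r))

partitions : ℕ → List (List ℕ)
partitions n = partsLE n n n

toℚ : ℕ → ℚ
toℚ n = + n ℚ./ 1

sumℚ : List ℚ → ℚ
sumℚ = foldr ℚ._+_ 0ℚ

-- 𝔯_D is p-positive: 𝔯_D = Σ_{λ ⊢ |D|} c_λ p_λ with all c_λ ≥ 0,
-- equality of power series checked coefficientwise on every monomial x^a
-- (a ranges over all finite exponent sequences).
PPositive : Diagram → Set
PPositive D =
  Σ (List ℕ → ℚ) λ c →
    (∀ lam → lam ∈ partitions (length D) → 0ℚ ℚ.≤ c lam) ×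
    (∀ a → toℚ (rCoeff D a) ≡ sumℚ (map (λ lam → c lam ℚ.* toℚ (pCoeff lam a)) (partitions (length D))))

{-# OPTIONS --safe #-}

-- By the Leibniz rule and (1 + z)/(1 - z), the operator W_b = p_b^⊥ adjoint to multiplication by the
-- power sum p_b satisfies [W_b, p_a] = b δ_{ab} and [W_b, q_m] = 2 q_{m-b} for odd b. So for odd b and c
-- the functional L = W_1 W_b W_c, evaluated at the empty content, is nonnegative on every p_λ, hence on
-- every p-positive function. Two successive rows of a ribbon filling either satisfy the column condition
-- or can be glued into one row, so ribbons are alternating sums of products of q's, and for a ribbon of
-- size 1 + b + c and odd length L takes the value
--   8 (1 - Σ_x [x ∈ S] (1 - [x+y ∈ S] - [x+z ∈ S]) - Σ_{x,y} [x+y ∈ S]),   {x, y, z} = {1, b, c},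
-- S being the set of proper partial sums of the composition. With n the number of boxes, the value is
-- negative for b = k-1 in case (a), b = n-m in case (b), and for the odd one of b = k, k-1 in case (c).
module Submission where

open import Defs
open import Data.Bool.Base using (Bool; true; false; T; _∧_; _∨_; not; if_then_else_)
open import Data.Bool.ListAction using (all)
open import Data.Bool.Properties using (∧-assoc; ∧-identityʳ; ∧-zeroʳ; ∨-assoc; ∨-identityʳ; ∨-zeroʳ)
open import Data.Empty using (⊥-elim)
import Data.Integer.Base as ℤ
import Data.Integer.Properties as ℤₚ
open import Data.List.Base
  using (List; []; _∷_; _++_; _∷ʳ_; applyUpTo; concat; concatMap; length; map; replicate; reverse; upTo; zip)
open import Data.List.Membership.Propositional using (_∈_; find)
open import Data.List.Membership.Propositional.Properties using (∈-applyUpTo⁻; ∈-concatMap⁻; ∈-map⁻)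
open import Data.List.Properties using (++-identityʳ; length-++; length-map; length-upTo; map-∘; reverse-++)
open import Data.List.Relation.Unary.All using (All; []; _∷_)
open import Data.List.Relation.Unary.All.Properties using (∷ʳ⁻)
open import Data.List.Relation.Unary.Any using (Any; here; there)
open import Data.List.Relation.Unary.Any.Properties using (++⁺ʳ)
open import Data.List.Reverse using (Reverse; []; _∶_∶ʳ_; reverseView)
open import Data.Nat.Base as ℕ using (ℕ; zero; suc; _≤_; _<_; _>_; _≤ᵇ_; _<ᵇ_; _≡ᵇ_; _∸_; _⊓_; z≤n; s≤s)
open import Data.Nat.Coprimality using (1-coprimeTo) renaming (sym to coprime-sym)
open import Data.Nat.ListAction using (sum)
open import Data.Nat.ListAction.Properties using (sum-++)
import Data.Nat.Properties as ℕₚ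
open import Data.Product.Base using (_×_; _,_; ∃; proj₁; proj₂; swap)
open import Data.Rational.Base as ℚ using (ℚ; 0ℚ; 1ℚ; mkℚ; _+_; _*_; -_; _-_) renaming (_≤_ to _≤ℚ_)
import Data.Rational.Properties as ℚₚ
open import Data.Sum.Base using (_⊎_; inj₁; inj₂; [_,_]′)
open import Function.Base using (_∘_; id)
open import Function.Bundles using (_⇔_; mk⇔)
open import Level using (0ℓ)
open import Relation.Binary.Definitions using (tri<; tri≈; tri>)
open import Relation.Binary.PropositionalEquality
open import Relation.Nullary using (¬_)
open import Relation.Nullary.Decidable using (dec⇒maybe; toWitnessFalse)
open import Tactic.RingSolver using (solve-∀)
open import Tactic.RingSolver.Core.AlmostCommutativeRing using (AlmostCommutativeRing; fromCommutativeRing)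
open ≡-Reasoning

-- Coefficient functions carry no scalar product from which an adjoint could be taken, so W_b is
-- defined by its effect on exponents, and both commutators have to be derived from Newton's
-- identity by strong induction on b. Only odd b can serve: log((1 + z)/(1 - z)) is an odd series,
-- so an even W_b kills every product of q's. The hypotheses on D meet in the bracket. Since α_1 = 1
-- puts 1 into S, having W_1 among the operators makes most of the bracket cancel; odd n makes c = n
-- - 1 - b odd together with b; odd length makes the overall sign positive. Near the top, S contains
-- 1, ..., k-1 but not k, and near the bottom it ends in a gap or a run measured by m; b is chosen
-- at the edge of such a run.

ℚring : AlmostCommutativeRing 0ℓ 0ℓ
ℚring = fromCommutativeRing ℚₚ.+-*-commutativeRing λ p → dec⇒maybe (0ℚ ℚₚ.≟ p)

zero-lin : ∀ c → 0ℚ ≡ 0ℚ + c * 0ℚ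
zero-lin = solve-∀ ℚring

interchange : ∀ x y z w c → (x + c * y) + (z + c * w) ≡ (x + z) + c * (y + w)
interchange = solve-∀ ℚring

-- Symmetric functions as coefficient functions: content ↦ coefficient of the monomial.
Fn : Set
Fn = List ℕ → ℚ

infix 4 _≈_
_≈_ : Fn → Fn → Set
f ≈ g = ∀ a → f a ≡ g a

infixl 6 _⊕_
_⊕_ : Fn → Fn → Fn
(f ⊕ g) a = f a + g a

infixr 7 _⊙_
_⊙_ : ℚ → Fn → Fn
(k ⊙ f) a = k * f a

𝟘 : Fn
𝟘 _ = 0ℚ

at : ℕ → Fn → Fn
at x f a = f (x ∷ a)

-- Equality of functions is pointwise, so `h` is a separate argument: one property then carries
-- linearity and congruence together, congruence being the case `k` = 0.
Linear : (Fn → Fn) → Set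
Linear O = ∀ {h} f g k → h ≈ f ⊕ k ⊙ g → O h ≈ O f ⊕ k ⊙ O g

module _ {O : Fn → Fn} (lin : Linear O) where

  lin-cong : ∀ f g → f ≈ g → O f ≈ O g
  lin-cong f g e a = trans (lin g g 0ℚ (λ a → trans (e a) (p (g a) (g a))) a) (sym (p (O g a) (O g a)))
    where
    p : ∀ x y → x ≡ x + 0ℚ * y
    p = solve-∀ ℚring

  lin-⊕ : ∀ f g → O (f ⊕ g) ≈ O f ⊕ O g
  lin-⊕ f g a = trans (lin f g 1ℚ (λ a → p (f a) (g a)) a) (sym (p (O f a) (O g a)))
    where
    p : ∀ x y → x + y ≡ x + 1ℚ * y
    p = solve-∀ ℚring

  lin-𝟘 : O 𝟘 ≈ 𝟘
  lin-𝟘 a = trans (lin 𝟘 𝟘 (- 1ℚ) (λ _ → refl) a) (p (O 𝟘 a))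
    where
    p : ∀ x → x + (- 1ℚ) * x ≡ 0ℚ
    p = solve-∀ ℚring

  lin-⊙ : ∀ c f → O (c ⊙ f) ≈ c ⊙ O f
  lin-⊙ c f a = trans (lin 𝟘 f c (λ a → sym (ℚₚ.+-identityˡ (c * f a))) a)
                      (trans (cong (_+ c * O f a) (lin-𝟘 a)) (ℚₚ.+-identityˡ _))

toℚ-+ : ∀ m n → toℚ (m ℕ.+ n) ≡ toℚ m + toℚ n
toℚ-+ m n = sym (trans (cong₂ _+_ (canon m) (canon n))
  (cong (ℚ._/ 1) (cong₂ ℤ._+_ (ℤₚ.*-identityʳ (ℤ.+ m)) (ℤₚ.*-identityʳ (ℤ.+ n)))))
  where
  canon : ∀ k → toℚ k ≡ mkℚ (ℤ.+ k) 0 (coprime-sym (1-coprimeTo k))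
  canon k = ℚₚ.normalize-coprime (coprime-sym (1-coprimeTo k))

toℚ-nonneg : ∀ n → 0ℚ ≤ℚ toℚ n
toℚ-nonneg n = ℚₚ.nonNegative⁻¹ (toℚ n) {{ℚₚ.normalize-nonNeg n 1}}

-- toℚ, kept from unfolding into computations of gcds
abstract
  num : ℕ → ℚ
  num = toℚ

  num≡toℚ : ∀ n → num n ≡ toℚ n
  num≡toℚ n = refl

  num-zero : num 0 ≡ 0ℚ
  num-zero = refl

  num-+ : ∀ m n → num (m ℕ.+ n) ≡ num m + num n
  num-+ = toℚ-+

  num-nonneg : ∀ n → 0ℚ ≤ℚ num n
  num-nonneg = toℚ-nonneg

num-suc : ∀ n → num (suc n) ≡ num n + 1ℚ
num-suc n = trans (cong num (ℕₚ.+-comm 1 n)) (trans (num-+ n 1) (cong (num n +_) (num≡toℚ 1)))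

-- conv h k r a = Σ_{j=1}^{k} h_j (k + r - j ∷ a)
conv : (ℕ → Fn) → ℕ → ℕ → Fn
conv h zero r a = 0ℚ
conv h (suc k) r a = h (suc k) (r ∷ a) + conv h k (suc r) a

conv-cong : ∀ h h' k r → (∀ j → j ≤ k → h j ≈ h' j) → conv h k r ≈ conv h' k r
conv-cong h h' zero r e a = refl
conv-cong h h' (suc k) r e a =
  cong₂ _+_ (e (suc k) ℕₚ.≤-refl (r ∷ a)) (conv-cong h h' k (suc r) (λ j l → e j (ℕₚ.m≤n⇒m≤1+n l)) a)

conv-lin : ∀ {h} h₁ h₂ c k r → (∀ j → h j ≈ h₁ j ⊕ c ⊙ h₂ j) → conv h k r ≈ conv h₁ k r ⊕ c ⊙ conv h₂ k r
conv-lin h₁ h₂ c zero r e a = zero-lin c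
conv-lin h₁ h₂ c (suc k) r e a =
  trans (cong₂ _+_ (e (suc k) (r ∷ a)) (conv-lin h₁ h₂ c k (suc r) e a))
        (interchange (h₁ (suc k) (r ∷ a)) (h₂ (suc k) (r ∷ a)) (conv h₁ k (suc r) a) (conv h₂ k (suc r) a) c)

conv-⊕ : ∀ h₁ h₂ k r → conv (λ j → h₁ j ⊕ h₂ j) k r ≈ conv h₁ k r ⊕ conv h₂ k r
conv-⊕ h₁ h₂ k r a = trans (conv-lin h₁ h₂ 1ℚ k r (λ j a → p (h₁ j a) (h₂ j a)) a) (sym (p (conv h₁ k r a) (conv h₂ k r a)))
  where
  p : ∀ x y → x + y ≡ x + 1ℚ * y
  p = solve-∀ ℚring

conv-front : ∀ h k r a → conv h (suc k) r a ≡ h 1 (k ℕ.+ r ∷ a) + conv (h ∘ suc) k r a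
conv-front h zero r a = refl
conv-front h (suc k) r a =
  trans (cong (h (suc (suc k)) (r ∷ a) +_) (conv-front h k (suc r) a))
  (trans (p (h (suc (suc k)) (r ∷ a)) (h 1 (k ℕ.+ suc r ∷ a)) (conv (h ∘ suc) k (suc r) a))
         (cong (λ z → h 1 (z ∷ a) + (h (suc (suc k)) (r ∷ a) + conv (h ∘ suc) k (suc r) a)) (ℕₚ.+-suc k r)))
  where
  p : ∀ x y z → x + (y + z) ≡ y + (x + z)
  p = solve-∀ ℚring

-- Adjoints of the power sums

mutual
  -- The adjoint of multiplication by the power sum p_b, acting on the first variables:
  -- from h_b^⊥ = at b and Newton's identity b h_b = Σ_{j=1}^{b} h_{b-j} p_j.
  W : ℕ → Fn → Fn
  W zero f a = 0ℚ
  W (suc b) f a = num (suc b) * f (suc b ∷ a) - Wsum f b 1 a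

  Wsum : Fn → ℕ → ℕ → Fn
  Wsum f zero r a = 0ℚ
  Wsum f (suc k) r a = W (suc k) f (r ∷ a) + Wsum f k (suc r) a

-- `Wsum` repeats `conv` inside the mutual block to make the recursion of `W` structural; the
-- general lemmas on `conv` are reached through this equation.
Wsum≡conv : ∀ f k r a → Wsum f k r a ≡ conv (λ j → W j f) k r a
Wsum≡conv f zero r a = refl
Wsum≡conv f (suc k) r a = cong (W (suc k) f (r ∷ a) +_) (Wsum≡conv f k (suc r) a)

mutual
  W-linear : ∀ b → Linear (W b)
  W-linear zero f g k e a = zero-lin k
  W-linear (suc b) f g k e a =
    trans (cong₂ (λ x y → num (suc b) * x - y) (e (suc b ∷ a)) (Wsum-linear b 1 f g k e a))
          (p (num (suc b)) (f (suc b ∷ a)) (g (suc b ∷ a)) (Wsum f b 1 a) (Wsum g b 1 a) k)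
    where
    p : ∀ b x y z w c → b * (x + c * y) - (z + c * w) ≡ (b * x - z) + c * (b * y - w)
    p = solve-∀ ℚring

  Wsum-linear : ∀ k r → Linear (λ f a → Wsum f k r a)
  Wsum-linear zero r f g k e a = zero-lin k
  Wsum-linear (suc j) r f g k e a =
    trans (cong₂ _+_ (W-linear (suc j) f g k e (r ∷ a)) (Wsum-linear j (suc r) f g k e a))
          (interchange (W (suc j) f (r ∷ a)) (W (suc j) g (r ∷ a)) (Wsum f j (suc r) a) (Wsum g j (suc r) a) k)

-- Compatibility between different numbers of variables. It makes h_0^⊥, which reads off exponent 0
-- in a new first variable, the identity.
ZeroInsensitive : Fn → Set
ZeroInsensitive f = ∀ u v → f (u ++ 0 ∷ v) ≡ f (u ++ v)

mutual
  W-ZI : ∀ b f → ZeroInsensitive f → ZeroInsensitive (W b f)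
  W-ZI zero f z u v = refl
  W-ZI (suc b) f z u v = cong₂ (λ x y → num (suc b) * x - y) (z (suc b ∷ u) v) (Wsum-ZI b 1 f z u v)

  Wsum-ZI : ∀ k r f → ZeroInsensitive f → ZeroInsensitive (Wsum f k r)
  Wsum-ZI zero r f z u v = refl
  Wsum-ZI (suc k) r f z u v = cong₂ _+_ (W-ZI (suc k) f z (r ∷ u) v) (Wsum-ZI k (suc r) f z u v)

newton₁ : ∀ f k a → conv (λ j → W j f) k 1 a ≡ num (suc k) * f (suc k ∷ a) - W (suc k) f a
newton₁ f k a = trans (sym (Wsum≡conv f k 1 a)) (p (num (suc k) * f (suc k ∷ a)) (Wsum f k 1 a))
  where
  p : ∀ x y → y ≡ x - (x - y)
  p = solve-∀ ℚring

-- The full Newton identity: the term of index k has exponent 0 in the new variable, where zero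
-- insensitivity applies, and it cancels the correction in `newton₁`.
newton₀ : ∀ f → ZeroInsensitive f → ∀ k a → conv (λ j → W j f) k 0 a ≡ num k * f (k ∷ a)
newton₀ f z zero a = sym (trans (cong (_* f (0 ∷ a)) num-zero) (ℚₚ.*-zeroˡ (f (0 ∷ a))))
newton₀ f z (suc k) a =
  trans (cong₂ _+_ (W-ZI (suc k) f z [] a) (newton₁ f k a))
        (p (W (suc k) f a) (num (suc k) * f (suc k ∷ a)))
  where
  p : ∀ x y → x + (y - x) ≡ y
  p = solve-∀ ℚring

≡true : ∀ {b} → T b → b ≡ true
≡true {true} _ = refl

≡false : ∀ {b} → (T b → T false) → b ≡ false
≡false {false} _ = refl
≡false {true} f = ⊥-elim (f _)

≤ᵇ-true : ∀ {m n} → m ≤ n → (m ≤ᵇ n) ≡ true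
≤ᵇ-true l = ≡true (ℕₚ.≤⇒≤ᵇ l)

≤ᵇ-false : ∀ {m n} → n < m → (m ≤ᵇ n) ≡ false
≤ᵇ-false {m} {n} l = ≡false λ t → ℕₚ.<⇒≱ l (ℕₚ.≤ᵇ⇒≤ m n t)

≡ᵇ-true : ∀ {m n} → m ≡ n → (m ≡ᵇ n) ≡ true
≡ᵇ-true {m} {n} e = ≡true (ℕₚ.≡⇒≡ᵇ m n e)

≡ᵇ-false : ∀ {m n} → m ≢ n → (m ≡ᵇ n) ≡ false
≡ᵇ-false {m} {n} e = ≡false λ t → e (ℕₚ.≡ᵇ⇒≡ m n t)

-- Power sums

-- Multiplication by the power sum p_p; lower p takes x_i^p from the first variable.
lower : ℕ → Fn → Fn
lower p g [] = 0ℚ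
lower p g (x ∷ a) = if p ≤ᵇ x then g (x ∸ p ∷ a) else 0ℚ

P : ℕ → Fn → Fn
P p g [] = 0ℚ
P p g (x ∷ a) = lower p g (x ∷ a) + P p (at x g) a

toℚ-pCoeff : ∀ p lam a → toℚ (pCoeff (p ∷ lam) a) ≡ P p (toℚ ∘ pCoeff lam) a
toℚ-pCoeff p lam = go (pCoeff lam)
  where
  go : ∀ (g : List ℕ → ℕ) a → toℚ (sum (map g (choices p a))) ≡ P p (toℚ ∘ g) a
  tail : ∀ (g : List ℕ → ℕ) x a → toℚ (sum (map g (map (x ∷_) (choices p a)))) ≡ P p (at x (toℚ ∘ g)) a
  tail g x a = trans (cong (toℚ ∘ sum) (sym (map-∘ (choices p a)))) (go (g ∘ (x ∷_)) a)
  go g [] = refl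
  go g (x ∷ a) with p ≤ᵇ x
  ... | true = trans (toℚ-+ (g (x ∸ p ∷ a)) _) (cong (toℚ (g (x ∸ p ∷ a)) +_) (tail g x a))
  ... | false = trans (tail g x a) (sym (ℚₚ.+-identityˡ _))

lower-linear : ∀ p → Linear (lower p)
lower-linear p f g k e [] = zero-lin k
lower-linear p f g k e (x ∷ a) with p ≤ᵇ x
... | true = e (x ∸ p ∷ a)
... | false = zero-lin k

P-linear : ∀ p → Linear (P p)
P-linear p f g k e [] = zero-lin k
P-linear p f g k e (x ∷ a) =
  trans (cong₂ _+_ (lower-linear p f g k e (x ∷ a)) (P-linear p (at x f) (at x g) k (λ a → e (x ∷ a)) a))
        (interchange (lower p f (x ∷ a)) (lower p g (x ∷ a)) (P p (at x f) a) (P p (at x g) a) k)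

at-ZI : ∀ x f → ZeroInsensitive f → ZeroInsensitive (at x f)
at-ZI x f z u v = z (x ∷ u) v

-- A variable of exponent 0 cannot supply a positive power; hence the degree `suc p`.
P-ZI : ∀ p g → ZeroInsensitive g → ZeroInsensitive (P (suc p) g)
P-ZI p g z [] v = trans (ℚₚ.+-identityˡ _) (lin-cong (P-linear (suc p)) (at 0 g) g (z []) v)
P-ZI p g z (x ∷ u) v = cong₂ _+_ (low x) (P-ZI p (at x g) (at-ZI x g z) u v)
  where
  low : ∀ x → lower (suc p) g (x ∷ u ++ 0 ∷ v) ≡ lower (suc p) g (x ∷ u ++ v)
  low x with suc p ≤ᵇ x
  ... | true = z (x ∸ suc p ∷ u) v
  ... | false = refl

-- `conv` acts on the first variable only, so the part of p_p drawn from the other variables passes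
-- through it.
conv-P : ∀ p (h : ℕ → Fn) k r a → conv (λ j → P p (h j)) k r a ≡ conv (λ j → lower p (h j)) k r a + P p (conv h k r) a
conv-P p h zero r a = sym (trans (ℚₚ.+-identityˡ _) (lin-𝟘 (P-linear p) a))
conv-P p h (suc k) r a = begin
  lower p (h (suc k)) (r ∷ a) + P p (at r (h (suc k))) a + conv (λ j → P p (h j)) k (suc r) a
    ≡⟨ cong (lower p (h (suc k)) (r ∷ a) + P p (at r (h (suc k))) a +_) (conv-P p h k (suc r) a) ⟩
  lower p (h (suc k)) (r ∷ a) + P p (at r (h (suc k))) a + (conv (λ j → lower p (h j)) k (suc r) a + P p (conv h k (suc r)) a)
    ≡⟨ q (lower p (h (suc k)) (r ∷ a)) (P p (at r (h (suc k))) a)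
           (conv (λ j → lower p (h j)) k (suc r) a) (P p (conv h k (suc r)) a) ⟩
  lower p (h (suc k)) (r ∷ a) + conv (λ j → lower p (h j)) k (suc r) a + (P p (at r (h (suc k))) a + P p (conv h k (suc r)) a)
    ≡⟨ cong (lower p (h (suc k)) (r ∷ a) + conv (λ j → lower p (h j)) k (suc r) a +_)
           (sym (lin-⊕ (P-linear p) (at r (h (suc k))) (conv h k (suc r)) a)) ⟩
  _ ∎
  where
  q : ∀ x y z w → x + y + (z + w) ≡ x + z + (y + w)
  q = solve-∀ ℚring

lower-small : ∀ {p x} g a → x < p → lower p g (x ∷ a) ≡ 0ℚ
lower-small {p} {x} g a l rewrite ≤ᵇ-false l = refl

lower-large : ∀ p x g a → lower p g (p ℕ.+ x ∷ a) ≡ g (x ∷ a)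
lower-large p x g a rewrite ≤ᵇ-true (ℕₚ.m≤m+n p x) | ℕₚ.m+n∸m≡n p x = refl

conv-lower-small : ∀ p (h : ℕ → Fn) k r a → k ℕ.+ r ≤ p → conv (λ j → lower p (h j)) k r a ≡ 0ℚ
conv-lower-small p h zero r a l = refl
conv-lower-small p h (suc k) r a l =
  trans (cong₂ _+_ (lower-small (h (suc k)) a (ℕₚ.≤-trans (s≤s (ℕₚ.m≤n+m r k)) l))
                   (conv-lower-small p h k (suc r) a (subst (_≤ p) (sym (ℕₚ.+-suc k r)) l)))
        (ℚₚ.+-identityˡ 0ℚ)

conv-lower-large : ∀ p (h : ℕ → Fn) q r a → conv (λ j → lower p (h j)) q (p ℕ.+ r) a ≡ conv h q r a
conv-lower-large p h zero r a = refl
conv-lower-large p h (suc q) r a =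
  cong₂ _+_ (lower-large p r (h (suc q)) a)
            (trans (cong (λ z → conv (λ j → lower p (h j)) q z a) (sym (ℕₚ.+-suc p r))) (conv-lower-large p h q (suc r) a))

-- The first exponent runs upward from `r`: the first `d` terms stay below `d + r` and vanish, and
-- in the others subtracting `d + r` restarts the exponent at 0.
conv-lower : ∀ d (h : ℕ → Fn) q r a → conv (λ j → lower (d ℕ.+ r) (h j)) (d ℕ.+ q) r a ≡ conv h q 0 a
conv-lower zero h q r a =
  trans (cong (λ z → conv (λ j → lower r (h j)) q z a) (sym (ℕₚ.+-identityʳ r))) (conv-lower-large r h q 0 a)
conv-lower (suc d) h q r a =
  trans (cong₂ _+_ (lower-small (h (suc (d ℕ.+ q))) a (s≤s (ℕₚ.m≤n+m r d)))
                   (trans (cong (λ z → conv (λ j → lower z (h j)) (d ℕ.+ q) (suc r) a) (sym (ℕₚ.+-suc d r)))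
                          (conv-lower d h q (suc r) a)))
        (ℚₚ.+-identityˡ _)

-- the commutator of W b and P p, as a multiple of g
δ[_,_]_ : ℕ → ℕ → Fn → Fn
(δ[ b , p ] g) a = if b ≡ᵇ p then num p * g a else 0ℚ

δ-off : ∀ {b p} g a → b ≢ p → (δ[ b , p ] g) a ≡ 0ℚ
δ-off {p = p} g a ne = cong (if_then num p * g a else 0ℚ) (≡ᵇ-false ne)

δ-on : ∀ p g a → (δ[ p , p ] g) a ≡ num p * g a
δ-on p g a = cong (if_then num p * g a else 0ℚ) (≡ᵇ-true {p} refl)

conv-δ-small : ∀ p g k r a → k < p → conv (λ j → δ[ j , p ] g) k r a ≡ 0ℚ
conv-δ-small p g zero r a l = refl
conv-δ-small p g (suc k) r a l =
  trans (cong₂ _+_ (δ-off g (r ∷ a) (ℕₚ.<⇒≢ l)) (conv-δ-small p g k (suc r) a (ℕₚ.<-trans (ℕₚ.n<1+n k) l)))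
        (ℚₚ.+-identityˡ 0ℚ)

conv-δ-large : ∀ p e g r a → conv (λ j → δ[ j , suc p ] g) (e ℕ.+ suc p) r a ≡ num (suc p) * g (e ℕ.+ r ∷ a)
conv-δ-large p zero g r a =
  trans (cong₂ _+_ (δ-on (suc p) g (r ∷ a)) (conv-δ-small (suc p) g p (suc r) a ℕₚ.≤-refl)) (ℚₚ.+-identityʳ _)
conv-δ-large p (suc e) g r a =
  trans (cong₂ _+_ (δ-off g (r ∷ a) (λ q → ℕₚ.<⇒≢ (s≤s (ℕₚ.m≤n+m (suc p) e)) (sym q))) (conv-δ-large p e g (suc r) a))
  (trans (ℚₚ.+-identityˡ _) (cong (λ z → num (suc p) * g (z ∷ a)) (ℕₚ.+-suc e r)))

-- In the recursion for `W (suc k)` the terms with p drawn from later variables recombine by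
-- Newton's identity to `P p⁺ (W (suc k) g)`. The commutator is therefore
-- `num (suc k) * lo - CL - CD`: the direct contribution of the first variable, the same inside the
-- Newton sum, and the earlier commutators.
W-P : ∀ p g → ZeroInsensitive g → ∀ b → W b (P (suc p) g) ≈ P (suc p) (W b g) ⊕ δ[ b , suc p ] g
W-P p g z b = below (suc b) b ℕₚ.≤-refl
  where
  p⁺ = suc p
  below : ∀ n b → b < n → W b (P p⁺ g) ≈ P p⁺ (W b g) ⊕ δ[ b , p⁺ ] g
  below n zero l a = sym (trans (ℚₚ.+-identityʳ _) (lin-𝟘 (P-linear p⁺) a))
  below (suc n) (suc k) (s≤s l) a = finish (ℕₚ.<-≤-connex (suc k) p⁺)
    where
    A = num (suc k) * P p⁺ (at (suc k) g) a
    PW : P p⁺ (conv (λ j → W j g) k 1) a ≡ A - P p⁺ (W (suc k) g) a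
    PW = trans (P-linear p⁺ (num (suc k) ⊙ at (suc k) g) (W (suc k) g) (- 1ℚ)
                  (λ a → trans (newton₁ g k a) (q (num (suc k) * g (suc k ∷ a)) (W (suc k) g a))) a)
         (trans (cong (_+ (- 1ℚ) * P p⁺ (W (suc k) g) a)
                  (lin-⊙ (P-linear p⁺) (num (suc k)) (at (suc k) g) a))
                (sym (q A (P p⁺ (W (suc k) g) a))))
      where
      q : ∀ x y → x - y ≡ x + (- 1ℚ) * y
      q = solve-∀ ℚring
    CL = conv (λ j → lower p⁺ (W j g)) k 1 a
    CD = conv (λ j → δ[ j , p⁺ ] g) k 1 a
    lo = lower p⁺ g (suc k ∷ a)
    expand : W (suc k) (P p⁺ g) a ≡ num (suc k) * lo - CL - CD + P p⁺ (W (suc k) g) a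
    expand = begin
      num (suc k) * (lo + P p⁺ (at (suc k) g) a) - Wsum (P p⁺ g) k 1 a
        ≡⟨ cong (λ y → num (suc k) * (lo + P p⁺ (at (suc k) g) a) - y)
             (trans (Wsum≡conv (P p⁺ g) k 1 a)
             (trans (conv-cong (λ j → W j (P p⁺ g)) (λ j → P p⁺ (W j g) ⊕ δ[ j , p⁺ ] g) k 1
                      (λ j j≤k → below n j (ℕₚ.≤-<-trans j≤k l)) a)
             (trans (conv-⊕ (λ j → P p⁺ (W j g)) (λ j → δ[ j , p⁺ ] g) k 1 a)
                    (cong (_+ CD) (trans (conv-P p⁺ (λ j → W j g) k 1 a) (cong (CL +_) PW)))))) ⟩
      num (suc k) * (lo + P p⁺ (at (suc k) g) a) - (CL + (A - P p⁺ (W (suc k) g) a) + CD)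
        ≡⟨ q (num (suc k)) lo (P p⁺ (at (suc k) g) a) CL (P p⁺ (W (suc k) g) a) CD ⟩
      num (suc k) * lo - CL - CD + P p⁺ (W (suc k) g) a ∎
      where
      q : ∀ k l p c w d → k * (l + p) - (c + (k * p - w) + d) ≡ k * l - c - d + w
      q = solve-∀ ℚring
    conclude : ∀ {l c d e} → lo ≡ l → CL ≡ c → CD ≡ d → (δ[ suc k , p⁺ ] g) a ≡ e →
               num (suc k) * l - c - d ≡ e → W (suc k) (P p⁺ g) a ≡ P p⁺ (W (suc k) g) a + (δ[ suc k , p⁺ ] g) a
    conclude el ec ed ee eq =
      trans expand (trans (cong (_+ P p⁺ (W (suc k) g) a)
        (trans (cong₂ _-_ (cong₂ (λ l c → num (suc k) * l - c) el ec) ed) (trans eq (sym ee))))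
        (ℚₚ.+-comm _ (P p⁺ (W (suc k) g) a)))
    finish : (suc k < p⁺ ⊎ p⁺ ≤ suc k) → W (suc k) (P p⁺ g) a ≡ P p⁺ (W (suc k) g) a + (δ[ suc k , p⁺ ] g) a
    finish (inj₁ k<p) = conclude
      (lower-small {p⁺} g a k<p)
      (conv-lower-small p⁺ (λ j → W j g) k 1 a (subst (_≤ p⁺) (ℕₚ.+-comm 1 k) (ℕₚ.<⇒≤ k<p)))
      (conv-δ-small p⁺ g k 1 a (ℕₚ.<-trans (ℕₚ.n<1+n k) k<p))
      (δ-off g a (ℕₚ.<⇒≢ k<p))
      (q (num (suc k)))
      where
      q : ∀ k → k * 0ℚ - 0ℚ - 0ℚ ≡ 0ℚ
      q = solve-∀ ℚring
    finish (inj₂ (s≤s p≤k)) = split (k ∸ p) (ℕₚ.m+[n∸m]≡n p≤k)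
      where
      split : ∀ d → p ℕ.+ d ≡ k → W (suc k) (P p⁺ g) a ≡ P p⁺ (W (suc k) g) a + (δ[ suc k , p⁺ ] g) a
      -- With `suc k` = `p⁺` + d the three terms are (`p⁺` + d) g(d ∷ a), then d g(d ∷ a) by
      -- `newton₀`, then `p⁺` g(d ∷ a), the last one only for d > 0. They cancel except at d = 0,
      -- where `p⁺` times g remains.
      split d e = conclude
        (trans (cong (λ y → lower p⁺ g (y ∷ a)) (cong suc (sym e))) (lower-large p⁺ d g a))
        (trans (cong₂ (λ y y' → conv (λ j → lower y (W j g)) y' 1 a) (ℕₚ.+-comm 1 p) (sym e))
               (trans (conv-lower p (λ j → W j g) d 1 a) (newton₀ g z d a)))
        (proj₁ (diagonal d e))
        (proj₂ (diagonal d e))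
        (trans (cong (λ y → y * g (d ∷ a) - num d * g (d ∷ a) - cd d)
                     (trans (cong num (sym (cong suc e))) (num-+ (suc p) d)))
               (rest d))
        where
        cd : ℕ → ℚ
        cd zero = 0ℚ
        cd (suc d) = num p⁺ * g (suc d ∷ a)
        val : ℕ → ℚ
        val zero = num p⁺ * g (0 ∷ a)
        val (suc d) = 0ℚ
        diagonal : ∀ d → p ℕ.+ d ≡ k → CD ≡ cd d × (δ[ suc k , p⁺ ] g) a ≡ val d
        diagonal zero e with trans (sym (ℕₚ.+-identityʳ p)) e
        ... | refl = conv-δ-small p⁺ g p 1 a ℕₚ.≤-refl , trans (δ-on p⁺ g a) (cong (num p⁺ *_) (sym (z [] a)))
        diagonal (suc d) refl =
          trans (cong (λ y → conv (λ j → δ[ j , p⁺ ] g) y 1 a) (trans (ℕₚ.+-suc p d) (ℕₚ.+-comm p⁺ d)))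
                (trans (conv-δ-large p d g 1 a) (cong (λ y → num p⁺ * g (y ∷ a)) (ℕₚ.+-comm d 1))) ,
          δ-off g a (λ q → ℕₚ.m+1+n≢m p (ℕₚ.suc-injective q))
        rest : ∀ d → (num p⁺ + num d) * g (d ∷ a) - num d * g (d ∷ a) - cd d ≡ val d
        rest zero = q (num p⁺) (num 0) (g (0 ∷ a))
          where
          q : ∀ x y z → (x + y) * z - y * z - 0ℚ ≡ x * z
          q = solve-∀ ℚring
        rest (suc d) = q (num p⁺) (num (suc d)) (g (suc d ∷ a))
          where
          q : ∀ x y z → (x + y) * z - y * z - x * z ≡ 0ℚ
          q = solve-∀ ℚring

-- Nonnegativity on p-positive functions

Wl : List ℕ → Fn → Fn
Wl [] f = f
Wl (b ∷ B) f = Wl B (W b f)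

Wl-linear : ∀ B → Linear (Wl B)
Wl-linear [] f g k e = e
Wl-linear (b ∷ B) f g k e = Wl-linear B (W b f) (W b g) k (W-linear b f g k e)

-- Quantifying over all lists of operators makes the property stable under every `W b`, as the
-- induction in `P-nonneg` requires.
WNonNegative : Fn → Set
WNonNegative g = ∀ B → 0ℚ ≤ℚ Wl B g []

+-nonneg : ∀ {x y} → 0ℚ ≤ℚ x → 0ℚ ≤ℚ y → 0ℚ ≤ℚ x + y
+-nonneg = ℚₚ.+-mono-≤

*-nonneg : ∀ {x y} → 0ℚ ≤ℚ x → 0ℚ ≤ℚ y → 0ℚ ≤ℚ x * y
*-nonneg {x} {y} p q =
  ℚₚ.nonNegative⁻¹ (x * y) {{ℚₚ.nonNeg*nonNeg⇒nonNeg x {{ℚ.nonNegative p}} y {{ℚ.nonNegative q}}}}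

-- Moving an operator past the power sum adds only a nonnegative multiple of `g`; once no operator
-- is left, a product with a power sum of positive degree has constant term 0.
P-nonneg : ∀ p g → ZeroInsensitive g → WNonNegative g → WNonNegative (P (suc p) g)
P-nonneg p g z w [] = ℚₚ.≤-refl
P-nonneg p g z w (b ∷ B) = subst (0ℚ ≤ℚ_) (sym eq)
  (+-nonneg (P-nonneg p (W b g) (W-ZI b g z) (λ B → w (b ∷ B)) B) (*-nonneg c≥0 (w B)))
  where
  c = if b ≡ᵇ suc p then num (suc p) else 0ℚ
  c≥0 : 0ℚ ≤ℚ c
  c≥0 with b ≡ᵇ suc p
  ... | true = num-nonneg (suc p)
  ... | false = ℚₚ.≤-refl
  δ≡ : ∀ a → (δ[ b , suc p ] g) a ≡ c * g a
  δ≡ a with b ≡ᵇ suc p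
  ... | true = refl
  ... | false = sym (ℚₚ.*-zeroˡ (g a))
  eq : Wl B (W b (P (suc p) g)) [] ≡ Wl B (P (suc p) (W b g)) [] + c * Wl B g []
  eq = Wl-linear B (P (suc p) (W b g)) g c
         (λ a → trans (W-P p g z b a) (cong (P (suc p) (W b g) a +_) (δ≡ a))) []

one : Fn
one a = toℚ (pCoeff [] a)

one-ZI : ZeroInsensitive one
one-ZI u v = cong (λ b → toℚ (if b then 1 else 0)) (go u)
  where
  go : ∀ u → all (_≡ᵇ 0) (u ++ 0 ∷ v) ≡ all (_≡ᵇ 0) (u ++ v)
  go [] = refl
  go (x ∷ u) = cong ((x ≡ᵇ 0) ∧_) (go u)

mutual
  W-one : ∀ b → W b one ≈ 𝟘
  W-one zero a = refl
  W-one (suc b) a = trans (cong (λ y → num (suc b) * 0ℚ - y) (Wsum-one b 1 a)) (q (num (suc b)))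
    where
    q : ∀ k → k * 0ℚ - 0ℚ ≡ 0ℚ
    q = solve-∀ ℚring

  Wsum-one : ∀ k r a → Wsum one k r a ≡ 0ℚ
  Wsum-one zero r a = refl
  Wsum-one (suc k) r a = trans (cong₂ _+_ (W-one (suc k) (r ∷ a)) (Wsum-one k (suc r) a)) (ℚₚ.+-identityˡ 0ℚ)

one-nonneg : WNonNegative one
one-nonneg [] = toℚ-nonneg 1
one-nonneg (b ∷ B) =
  ℚₚ.≤-reflexive (sym (trans (lin-cong (Wl-linear B) (W b one) 𝟘 (W-one b) []) (lin-𝟘 (Wl-linear B) [])))

powerSum-nonneg : ∀ {lam} → All (1 ≤_) lam → ZeroInsensitive (toℚ ∘ pCoeff lam) × WNonNegative (toℚ ∘ pCoeff lam)
powerSum-nonneg [] = one-ZI , one-nonneg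
powerSum-nonneg {suc p ∷ lam} (_ ∷ l) =
  let (z , w) = powerSum-nonneg l
      g = toℚ ∘ pCoeff lam
      e = toℚ-pCoeff (suc p) lam
  in (λ u v → trans (e (u ++ 0 ∷ v)) (trans (P-ZI p g z u v) (sym (e (u ++ v))))) ,
     (λ B → subst (0ℚ ≤ℚ_) (sym (lin-cong (Wl-linear B) (toℚ ∘ pCoeff (suc p ∷ lam)) (P (suc p) g) e [])) (P-nonneg p g z w B))

partsLE-positive : ∀ fuel r m {lam} → lam ∈ partsLE fuel r m → All (1 ≤_) lam
partsLE-positive zero zero m (here refl) = []
partsLE-positive (suc fuel) zero m (here refl) = []
partsLE-positive (suc fuel) (suc r) m i
  with find (∈-concatMap⁻ (λ k → map (k ∷_) (partsLE fuel (suc r ∸ k) k)) {xs = applyUpTo suc (m ⊓ suc r)} i)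
... | k , k∈ , i' with ∈-applyUpTo⁻ suc k∈ | ∈-map⁻ (k ∷_) i'
... | j , _ , refl | mu , mu∈ , refl = s≤s z≤n ∷ partsLE-positive fuel (r ∸ j) (suc j) mu∈

pPositive-nonneg : ∀ D → PPositive D → WNonNegative (toℚ ∘ rCoeff D)
pPositive-nonneg D (c , c≥0 , eq) B =
  subst (0ℚ ≤ℚ_) (sym (lin-cong (Wl-linear B) (toℚ ∘ rCoeff D) (combination (partitions (length D))) eq []))
    (go (partitions (length D)) (λ lam i → c≥0 lam i , partsLE-positive (length D) (length D) (length D) i))
  where
  combination : List (List ℕ) → Fn
  combination ps a = sumℚ (map (λ lam → c lam * toℚ (pCoeff lam a)) ps)
  go : ∀ ps → (∀ lam → lam ∈ ps → 0ℚ ≤ℚ c lam × All (1 ≤_) lam) → 0ℚ ≤ℚ Wl B (combination ps) []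
  go [] h = ℚₚ.≤-reflexive (sym (lin-𝟘 (Wl-linear B) []))
  go (lam ∷ ps) h = subst (0ℚ ≤ℚ_)
    (sym (Wl-linear B (combination ps) (toℚ ∘ pCoeff lam) (c lam) (λ a → ℚₚ.+-comm _ (combination ps a)) []))
    (+-nonneg (go ps (λ lam i → h lam (there i)))
              (*-nonneg (proj₁ (h lam (here refl))) (proj₂ (powerSum-nonneg (proj₂ (h lam (here refl)))) B)))

-- The functions q_m

-- Multiplication by q_m, the degree m part of ∏ (1 + x_i t)/(1 - x_i t); the recursion on the
-- first variable clears the denominator 1 - x₁ t.
Q : ℕ → Fn → Fn
Q zero g a = g a
Q (suc m) g [] = 0ℚ
Q (suc m) g (zero ∷ a) = Q (suc m) (at 0 g) a
Q (suc m) g (suc x ∷ a) = Q m g (x ∷ a) + Q (suc m) (at (suc x) g) a + Q m (at x g) a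

Q-linear : ∀ m → Linear (Q m)
Q-linear zero f g k e a = e a
Q-linear (suc m) f g k e [] = zero-lin k
Q-linear (suc m) f g k e (zero ∷ a) = Q-linear (suc m) (at 0 f) (at 0 g) k (λ a → e (0 ∷ a)) a
Q-linear (suc m) f g k e (suc x ∷ a) =
  trans (cong₂ _+_ (cong₂ _+_ (Q-linear m f g k e (x ∷ a))
                              (Q-linear (suc m) (at (suc x) f) (at (suc x) g) k (λ a → e (suc x ∷ a)) a))
                   (Q-linear m (at x f) (at x g) k (λ a → e (x ∷ a)) a))
        (p (Q m f (x ∷ a)) (Q m g (x ∷ a)) (Q (suc m) (at (suc x) f) a) (Q (suc m) (at (suc x) g) a)
           (Q m (at x f) a) (Q m (at x g) a) k)
  where
  p : ∀ x x' y y' z z' c → (x + c * x') + (y + c * y') + (z + c * z') ≡ (x + y + z) + c * (x' + y' + z')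
  p = solve-∀ ℚring

Q-ZI : ∀ m g → ZeroInsensitive g → ZeroInsensitive (Q m g)
Q-ZI zero g z u v = z u v
Q-ZI (suc m) g z [] v = lin-cong (Q-linear (suc m)) (at 0 g) g (z []) v
Q-ZI (suc m) g z (zero ∷ u) v = Q-ZI (suc m) (at 0 g) (at-ZI 0 g z) u v
Q-ZI (suc m) g z (suc x ∷ u) v =
  cong₂ _+_ (cong₂ _+_ (Q-ZI m g z (x ∷ u) v) (Q-ZI (suc m) (at (suc x) g) (at-ZI (suc x) g z) u v))
            (Q-ZI m (at x g) (at-ZI x g z) u v)

conv-Q : ∀ m (h : ℕ → Fn) k r a → conv (λ j → Q (suc m) (h j)) k (suc r) a ≡
       conv (λ j → Q m (h j)) k r a + Q (suc m) (conv h k (suc r)) a + Q m (conv h k r) a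
conv-Q m h zero r a = sym (trans (cong₂ (λ x y → 0ℚ + x + y) (lin-𝟘 (Q-linear (suc m)) a) (lin-𝟘 (Q-linear m) a)) refl)
conv-Q m h (suc k) r a =
  trans (cong (Q (suc m) (h (suc k)) (suc r ∷ a) +_) (conv-Q m h k (suc r) a))
  (trans (p (Q m (h (suc k)) (r ∷ a)) (Q (suc m) (at (suc r) (h (suc k))) a) (Q m (at r (h (suc k))) a)
            (conv (λ j → Q m (h j)) k (suc r) a) (Q (suc m) (conv h k (suc (suc r))) a) (Q m (conv h k (suc r)) a))
         (sym (cong₂ (λ x y → conv (λ j → Q m (h j)) (suc k) r a + x + y)
           (lin-⊕ (Q-linear (suc m)) (at (suc r) (h (suc k))) (conv h k (suc (suc r))) a)
           (lin-⊕ (Q-linear m) (at r (h (suc k))) (conv h k (suc r)) a))))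
  where
  p : ∀ x y z u v w → x + y + z + (u + v + w) ≡ x + u + (y + v) + (z + w)
  p = solve-∀ ℚring

-- Multiplication by q_{m-j}, with value 0 for j > m, where truncated subtraction would wrongly give
-- q_0 = 1.
Q⁻ : ℕ → ℕ → Fn → Fn
Q⁻ m zero g = Q m g
Q⁻ zero (suc j) g = 𝟘
Q⁻ (suc m) (suc j) g = Q⁻ m j g

-- The coefficients of z c'(z)/c(z), where c(z) = (1 + z)/(1 - z).
ε : ℕ → ℚ
ε zero = 0ℚ
ε (suc zero) = 1ℚ + 1ℚ
ε (suc (suc n)) = ε n

-- S e g k m a = Σ_j e_j (Q (m - j) g) (k - j ∷ a), over 1 ≤ j ≤ min k m
S : (ℕ → ℚ) → Fn → ℕ → ℕ → Fn
S e g zero m a = 0ℚ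
S e g (suc k) zero a = 0ℚ
S e g (suc k) (suc m) a = e 1 * Q m g (k ∷ a) + S (e ∘ suc) g k m a

conv-Q⁻ : ∀ e g k m a → conv (λ j → e j ⊙ Q⁻ m j g) k 0 a ≡ S e g k m a
conv-Q⁻ e g zero m a = refl
conv-Q⁻ e g (suc k) zero a = vanish (suc k) 0
  where
  vanish : ∀ k r → conv (λ j → e j ⊙ Q⁻ 0 j g) k r a ≡ 0ℚ
  vanish zero r = refl
  vanish (suc k) r = trans (cong₂ _+_ (ℚₚ.*-zeroʳ (e (suc k))) (vanish k (suc r))) (ℚₚ.+-identityˡ 0ℚ)
conv-Q⁻ e g (suc k) (suc m) a =
  trans (conv-front (λ j → e j ⊙ Q⁻ (suc m) j g) k 0 a)
        (cong₂ _+_ (cong (λ y → e 1 * Q m g (y ∷ a)) (ℕₚ.+-identityʳ k)) (conv-Q⁻ (e ∘ suc) g k m a))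

-- Dividing by the factor c(x₁ t) of the first variable: 1/c(z) = 1 - 2z + 2z² - ..., with the even
-- powers collected on the left and the odd ones on the right. The induction unrolls the recursion
-- of `Q`.
S-ε : ∀ g → ZeroInsensitive g → ∀ k m a →
      S (ε ∘ suc) g k m a + Q m g (k ∷ a) ≡ S ε g k m a + Q m (at k g) a
S-ε g z zero m a = cong (0ℚ +_) (trans (Q-ZI m g z [] a) (sym (lin-cong (Q-linear m) (at 0 g) g (z []) a)))
S-ε g z (suc k) zero a = refl
S-ε g z (suc k) (suc m) a =
  trans (p (Q m g (k ∷ a)) (S ε g k m a) (Q (suc m) (at (suc k) g) a) (Q m (at k g) a))
  (trans (cong (λ y → Q m g (k ∷ a) + Q (suc m) (at (suc k) g) a + y) (sym (S-ε g z k m a)))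
         (p' (Q m g (k ∷ a)) (Q (suc m) (at (suc k) g) a) (S (ε ∘ suc) g k m a)))
  where
  p : ∀ x s y w → 0ℚ * x + s + (x + y + w) ≡ x + y + (s + w)
  p = solve-∀ ℚring
  p' : ∀ x y t → x + y + (t + x) ≡ (1ℚ + 1ℚ) * x + t + y
  p' = solve-∀ ℚring

Q⁻-ZI : ∀ m j g → ZeroInsensitive g → ZeroInsensitive (Q⁻ m j g)
Q⁻-ZI m zero g z = Q-ZI m g z
Q⁻-ZI zero (suc j) g z u v = refl
Q⁻-ZI (suc m) (suc j) g z = Q⁻-ZI m j g z

-- Newton's identity is used for `Q m g` (`C≡`) and for `g` under both `Q m` (`QW₀`) and `Q (suc m)`
-- (`QW₁`). All that survives are the sums of earlier commutators, weighted by ε.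
W-Q : ∀ m g → ZeroInsensitive g → ∀ b → W b (Q m g) ≈ Q m (W b g) ⊕ ε b ⊙ Q⁻ m b g
W-Q m g z b = below (suc b) b m ℕₚ.≤-refl
  where
  below : ∀ n b m → b < n → W b (Q m g) ≈ Q m (W b g) ⊕ ε b ⊙ Q⁻ m b g
  below n zero m l a = sym (trans (cong₂ _+_ (lin-𝟘 (Q-linear m) a) (ℚₚ.*-zeroˡ (Q m g a))) (ℚₚ.+-identityˡ 0ℚ))
  below n (suc k) zero l a = p (W (suc k) g a) (ε (suc k))
    where
    p : ∀ x e → x ≡ x + e * 0ℚ
    p = solve-∀ ℚring
  below (suc n) (suc k) (suc m) (s≤s l) a = begin
    num (suc k) * (x + y + z₀) - Wsum (Q (suc m) g) k 1 a
      ≡⟨ cong (λ s → num (suc k) * (x + y + z₀) - s) (trans (Wsum≡conv (Q (suc m) g) k 1 a) (trans (split (suc m) 1)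
           (cong (_+ E (suc m) 1) (trans (conv-Q m (λ j → W j g) k 0 a) (cong₂ (λ s t → C + s + t) QW₁ QW₀))))) ⟩
    num (suc k) * (x + y + z₀) - (C + (num (suc k) * y - w) + num k * z₀ + E (suc m) 1)
      ≡⟨ cong (λ c → c * (x + y + z₀) - (C + (c * y - w) + num k * z₀ + E (suc m) 1)) (num-suc k) ⟩
    (num k + 1ℚ) * (x + y + z₀) - (C + ((num k + 1ℚ) * y - w) + num k * z₀ + E (suc m) 1)
      ≡⟨ p₁ (num k) x y z₀ C w (E (suc m) 1) (E m 0) ⟩
    w + (num k * x - (C + E m 0)) + (E m 0 + z₀ + x - E (suc m) 1)
      ≡⟨ cong₂ (λ s t → w + (num k * x - s) + (t - E (suc m) 1)) C≡ E≡ ⟩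
    w + (num k * x - num k * x) + (ε (suc k) * Q⁻ m k g a + E (suc m) 1 - E (suc m) 1)
      ≡⟨ p₂ w (num k * x) (ε (suc k) * Q⁻ m k g a) (E (suc m) 1) ⟩
    w + ε (suc k) * Q⁻ m k g a ∎
    where
    x = Q m g (k ∷ a)
    y = Q (suc m) (at (suc k) g) a
    z₀ = Q m (at k g) a
    w = Q (suc m) (W (suc k) g) a
    C = conv (λ j → Q m (W j g)) k 0 a
    E : ℕ → ℕ → ℚ
    E m r = conv (λ j → ε j ⊙ Q⁻ m j g) k r a
    split : ∀ m r → conv (λ j → W j (Q m g)) k r a ≡ conv (λ j → Q m (W j g)) k r a + E m r
    split m r = trans (conv-cong (λ j → W j (Q m g)) (λ j → Q m (W j g) ⊕ ε j ⊙ Q⁻ m j g) k r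
                        (λ j j≤k → below n j m (ℕₚ.≤-<-trans j≤k l)) a)
                      (conv-⊕ (λ j → Q m (W j g)) (λ j → ε j ⊙ Q⁻ m j g) k r a)
    QW₀ : Q m (conv (λ j → W j g) k 0) a ≡ num k * z₀
    QW₀ = trans (lin-cong (Q-linear m) (conv (λ j → W j g) k 0) (num k ⊙ at k g) (newton₀ g z k) a)
                (lin-⊙ (Q-linear m) (num k) (at k g) a)
    QW₁ : Q (suc m) (conv (λ j → W j g) k 1) a ≡ num (suc k) * y - w
    QW₁ = trans (Q-linear (suc m) (num (suc k) ⊙ at (suc k) g) (W (suc k) g) (- 1ℚ)
                  (λ a → trans (newton₁ g k a) (p (num (suc k) * g (suc k ∷ a)) (W (suc k) g a))) a)
          (trans (cong (_+ (- 1ℚ) * w) (lin-⊙ (Q-linear (suc m)) (num (suc k)) (at (suc k) g) a)) (sym (p (num (suc k) * y) w)))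
      where
      p : ∀ x y → x - y ≡ x + (- 1ℚ) * y
      p = solve-∀ ℚring
    C≡ : C + E m 0 ≡ num k * x
    C≡ = trans (sym (split m 0)) (newton₀ (Q m g) (Q-ZI m g z) k a)
    -- The missing term of index `suc k` completes `E (suc m) 1` to a full sum starting at exponent
    -- 0; its leading coefficient ε 1 = 2 accounts for the two copies of `x`.
    E≡ : E m 0 + z₀ + x ≡ ε (suc k) * Q⁻ m k g a + E (suc m) 1
    E≡ = begin
      E m 0 + z₀ + x ≡⟨ cong (λ s → s + z₀ + x) (conv-Q⁻ ε g k m a) ⟩
      S ε g k m a + z₀ + x ≡⟨ cong (_+ x) (sym (S-ε g z k m a)) ⟩
      S (ε ∘ suc) g k m a + x + x ≡⟨ p (S (ε ∘ suc) g k m a) x ⟩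
      S ε g (suc k) (suc m) a ≡⟨ sym (conv-Q⁻ ε g (suc k) (suc m) a) ⟩
      ε (suc k) * Q⁻ m k g (0 ∷ a) + E (suc m) 1 ≡⟨ cong (λ s → ε (suc k) * s + E (suc m) 1) (Q⁻-ZI m k g z [] a) ⟩
      ε (suc k) * Q⁻ m k g a + E (suc m) 1 ∎
      where
      p : ∀ s x → s + x + x ≡ (1ℚ + 1ℚ) * x + s
      p = solve-∀ ℚring
    p₁ : ∀ k x y z c w e f → (k + 1ℚ) * (x + y + z) - (c + ((k + 1ℚ) * y - w) + k * z + e)
         ≡ w + (k * x - (c + f)) + (f + z + x - e)
    p₁ = solve-∀ ℚring
    p₂ : ∀ w x s e → w + (x - x) + (s + e - e) ≡ w + s
    p₂ = solve-∀ ℚring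

W-Q⁻ : ∀ m j g → ZeroInsensitive g → ∀ b → W b (Q⁻ m j g) ≈ Q⁻ m j (W b g) ⊕ ε b ⊙ Q⁻ m (j ℕ.+ b) g
W-Q⁻ m zero g z b = W-Q m g z b
W-Q⁻ zero (suc j) g z b a = trans (lin-𝟘 (W-linear b) a) (p (ε b))
  where
  p : ∀ c → 0ℚ ≡ 0ℚ + c * 0ℚ
  p = solve-∀ ℚring
W-Q⁻ (suc m) (suc j) g z b = W-Q⁻ m j g z b

-- Ribbon functions and their p₁ p_b p_c-coefficients

ι : Bool → ℚ
ι true = 1ℚ
ι false = 0ℚ

[_≐_] : ℕ → ℕ → ℚ
[ m ≐ n ] = ι (m ≡ᵇ n)

≐-guard : ∀ m n {x y} → (m ≡ n → x ≡ y) → [ m ≐ n ] * x ≡ [ m ≐ n ] * y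
≐-guard m n {x} {y} h with m ≡ᵇ n in e
... | true = cong (1ℚ *_) (h (ℕₚ.≡ᵇ⇒≡ m n (subst T (sym e) _)))
... | false = trans (ℚₚ.*-zeroˡ x) (sym (ℚₚ.*-zeroˡ y))

Q⁻-at-[] : ∀ m j g → Q⁻ m j g [] ≡ [ m ≐ j ] * g []
Q⁻-at-[] zero zero g = sym (ℚₚ.*-identityˡ (g []))
Q⁻-at-[] (suc m) zero g = sym (ℚₚ.*-zeroˡ (g []))
Q⁻-at-[] zero (suc j) g = sym (ℚₚ.*-zeroˡ (g []))
Q⁻-at-[] (suc m) (suc j) g = Q⁻-at-[] m j g

2ℚ 4ℚ 8ℚ : ℚ
2ℚ = 1ℚ + 1ℚ
4ℚ = 2ℚ * 2ℚ
8ℚ = 2ℚ * 4ℚ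

-- Each operator falls either on `g` or on the factor q, the latter lowering the degree by b at the
-- price of a factor 2. At the empty content only the choices that use up q exactly survive.
leibniz : ℕ → ℕ → Fn → List ℕ → ℚ
leibniz m j g [] = [ m ≐ j ] * g []
leibniz m j g (b ∷ B) = leibniz m j (W b g) B + 2ℚ * leibniz m (j ℕ.+ b) g B

Wl-Q⁻ : ∀ m j g → ZeroInsensitive g → ∀ {B} → All (λ b → ε b ≡ 2ℚ) B → Wl B (Q⁻ m j g) [] ≡ leibniz m j g B
Wl-Q⁻ m j g z [] = Q⁻-at-[] m j g
Wl-Q⁻ m j g z {b ∷ B} (o ∷ os) =
  trans (Wl-linear B (Q⁻ m j (W b g)) (Q⁻ m (j ℕ.+ b) g) 2ℚ
          (λ a → trans (W-Q⁻ m j g z b a) (cong (λ c → Q⁻ m j (W b g) a + c * Q⁻ m (j ℕ.+ b) g a) o)) [])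
        (cong₂ (λ x y → x + 2ℚ * y) (Wl-Q⁻ m j (W b g) (W-ZI b g z) os) (Wl-Q⁻ m (j ℕ.+ b) g z os))

R : ℕ → List ℕ → Fn
R a [] = Q a one
R a (b ∷ β) = Q a (R b β) ⊕ (- 1ℚ) ⊙ R (b ℕ.+ a) β

R-ZI : ∀ a β → ZeroInsensitive (R a β)
R-ZI a [] = Q-ZI a one one-ZI
R-ZI a (b ∷ β) u v =
  cong₂ (λ x y → x + (- 1ℚ) * y) (Q-ZI a (R b β) (R-ZI b β) u v) (R-ZI (b ℕ.+ a) β u v)

Wl-R : ∀ a b β {B} → All (λ b → ε b ≡ 2ℚ) B →
       Wl B (R a (b ∷ β)) [] ≡ leibniz a 0 (R b β) B + (- 1ℚ) * Wl B (R (b ℕ.+ a) β) []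
Wl-R a b β {B} o = trans (Wl-linear B (Q a (R b β)) (R (b ℕ.+ a) β) (- 1ℚ) (λ _ → refl) [])
  (cong (_+ (- 1ℚ) * Wl B (R (b ℕ.+ a) β) []) (Wl-Q⁻ a 0 (R b β) (R-ZI b β) o))

R-at-[] : ∀ a β → 1 ≤ a → R a β [] ≡ 0ℚ
R-at-[] (suc a) [] l = refl
R-at-[] (suc a) (b ∷ β) l = cong (λ y → 0ℚ + (- 1ℚ) * y) (R-at-[] (b ℕ.+ suc a) β (ℕₚ.≤-trans (s≤s z≤n) (ℕₚ.m≤n+m (suc a) b)))

-- membership of x in the set S of proper partial sums of the composition a ∷ β
mem : ℕ → ℕ → List ℕ → Bool
mem x a [] = false
mem x a (b ∷ β) = (a ≡ᵇ x) ∨ mem x (b ℕ.+ a) β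

μ : ℕ → ℕ → List ℕ → ℚ
μ x a β = ι (mem x a β)

mem-below : ∀ x a β → x < a → mem x a β ≡ false
mem-below x a [] l = refl
mem-below x a (b ∷ β) l =
  cong₂ _∨_ (≡ᵇ-false {a} {x} (λ e → ℕₚ.<⇒≢ l (sym e))) (mem-below x (b ℕ.+ a) β (ℕₚ.<-≤-trans l (ℕₚ.m≤n+m a b)))

mem-shift : ∀ p x a β → mem (p ℕ.+ x) (a ℕ.+ p) β ≡ mem x a β
mem-shift p x a [] = refl
mem-shift p x a (b ∷ β) = cong₂ _∨_
  (trans (cong (_≡ᵇ p ℕ.+ x) (ℕₚ.+-comm a p)) (cancel p))
  (trans (cong (λ y → mem (p ℕ.+ x) y β) (sym (ℕₚ.+-assoc b a p))) (mem-shift p x (b ℕ.+ a) β))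
  where
  cancel : ∀ p → (p ℕ.+ a ≡ᵇ p ℕ.+ x) ≡ (a ≡ᵇ x)
  cancel zero = refl
  cancel (suc p) = cancel p

μ-cons : ∀ x a b β → 1 ≤ b → μ x a (b ∷ β) ≡ [ a ≐ x ] + μ x (b ℕ.+ a) β
μ-cons x a b β l with a ≡ᵇ x in e
... | true = sym (trans (cong (λ y → 1ℚ + ι y) (mem-below x (b ℕ.+ a) β
               (subst (_< b ℕ.+ a) (ℕₚ.≡ᵇ⇒≡ a x (subst T (sym e) _)) (ℕₚ.+-monoˡ-≤ a l)))) (ℚₚ.+-identityʳ 1ℚ))
... | false = sym (ℚₚ.+-identityˡ _)

sgn : List ℕ → ℚ
sgn [] = 1ℚ
sgn (_ ∷ β) = - sgn β

sum-merge : ∀ a b β → b ℕ.+ a ℕ.+ sum β ≡ a ℕ.+ sum (b ∷ β)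
sum-merge a b β = trans (cong (ℕ._+ sum β) (ℕₚ.+-comm b a)) (ℕₚ.+-assoc a b (sum β))

private
  tail-sum : ∀ a b β x y → a ≡ x → a ℕ.+ sum (b ∷ β) ≡ x ℕ.+ y → b ℕ.+ sum β ≡ y
  tail-sum a b β x y refl e = ℕₚ.+-cancelˡ-≡ a _ _ e

module _ {b} (εb : ε b ≡ 2ℚ) where

  -- A single operator can use up only a single q, so only the complete merge of all rows
  -- contributes, and the sign counts the merges.
  W-R¹ : ∀ a β → 1 ≤ a → All (1 ≤_) β → a ℕ.+ sum β ≡ b → Wl (b ∷ []) (R a β) [] ≡ 2ℚ * sgn β
  W-R¹ a [] l _ e =
    trans (Wl-Q⁻ a 0 one one-ZI {b ∷ []} (εb ∷ []))
    (trans (cong₂ (λ x y → [ a ≐ 0 ] * x + 2ℚ * (ι y * 1ℚ)) (W-one b []) (≡ᵇ-true (trans (sym (ℕₚ.+-identityʳ a)) e)))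
           (p [ a ≐ 0 ]))
    where
    p : ∀ x → x * 0ℚ + (1ℚ + 1ℚ) * (1ℚ * 1ℚ) ≡ (1ℚ + 1ℚ) * 1ℚ
    p = solve-∀ ℚring
  W-R¹ (suc a) (c ∷ β) l (lc ∷ lβ) e = begin
    Wl (b ∷ []) (R (suc a) (c ∷ β)) []
      ≡⟨ Wl-R (suc a) c β {b ∷ []} (εb ∷ []) ⟩
    0ℚ * W b (R c β) [] + 2ℚ * ([ suc a ≐ b ] * R c β []) + (- 1ℚ) * Wl (b ∷ []) (R (c ℕ.+ suc a) β) []
      ≡⟨ cong₂ (λ x y → 0ℚ * W b (R c β) [] + 2ℚ * ([ suc a ≐ b ] * x) + (- 1ℚ) * y) (R-at-[] c β lc)
           (W-R¹ (c ℕ.+ suc a) β (ℕₚ.≤-trans lc (ℕₚ.m≤m+n c (suc a))) lβ (trans (sum-merge (suc a) c β) e)) ⟩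
    0ℚ * W b (R c β) [] + 2ℚ * ([ suc a ≐ b ] * 0ℚ) + (- 1ℚ) * (2ℚ * sgn β)
      ≡⟨ p (W b (R c β) []) [ suc a ≐ b ] (sgn β) ⟩
    2ℚ * sgn (c ∷ β) ∎
    where
    p : ∀ w x s → 0ℚ * w + (1ℚ + 1ℚ) * (x * 0ℚ) + (- 1ℚ) * ((1ℚ + 1ℚ) * s) ≡ (1ℚ + 1ℚ) * - s
    p = solve-∀ ℚring

≐-0 : ∀ a → 1 ≤ a → [ a ≐ 0 ] ≡ 0ℚ
≐-0 (suc a) l = refl

module _ {b c} (εb : ε b ≡ 2ℚ) (εc : ε c ≡ 2ℚ) where

  -- Both operators fall on one merged row, or they fall on two in succession. The second
  -- possibility needs b or c as a partial sum and has one merge fewer, hence the opposite sign.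
  W-R² : ∀ a β → 1 ≤ a → All (1 ≤_) β → a ℕ.+ sum β ≡ b ℕ.+ c →
         Wl (b ∷ c ∷ []) (R a β) [] ≡ 4ℚ * sgn β * (1ℚ - μ b a β - μ c a β)
  W-R² a [] l _ e =
    trans (Wl-Q⁻ a 0 one one-ZI {b ∷ c ∷ []} (εb ∷ εc ∷ []))
    (trans (cong₂ (λ x y → [ a ≐ 0 ] * x + 2ℚ * ([ a ≐ c ] * y) + 2ℚ * ([ a ≐ b ] * W c one [] + 2ℚ * ([ a ≐ b ℕ.+ c ] * 1ℚ)))
             (trans (lin-cong (W-linear c) (W b one) 𝟘 (W-one b) []) (lin-𝟘 (W-linear c) [])) (W-one b []))
    (trans (cong₂ (λ x y → [ a ≐ 0 ] * 0ℚ + 2ℚ * ([ a ≐ c ] * 0ℚ) + 2ℚ * ([ a ≐ b ] * x + 2ℚ * (ι y * 1ℚ)))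
             (W-one c []) (≡ᵇ-true (trans (sym (ℕₚ.+-identityʳ a)) e)))
           (p [ a ≐ 0 ] [ a ≐ c ] [ a ≐ b ])))
    where
    p : ∀ x y z → x * 0ℚ + (1ℚ + 1ℚ) * (y * 0ℚ) + (1ℚ + 1ℚ) * (z * 0ℚ + (1ℚ + 1ℚ) * (1ℚ * 1ℚ)) ≡
        (1ℚ + 1ℚ) * (1ℚ + 1ℚ) * 1ℚ * (1ℚ - 0ℚ - 0ℚ)
    p = solve-∀ ℚring
  W-R² a (d ∷ β) l (ld ∷ lβ) e = begin
    Wl (b ∷ c ∷ []) (R a (d ∷ β)) []
      ≡⟨ Wl-R a d β {b ∷ c ∷ []} (εb ∷ εc ∷ []) ⟩
    [ a ≐ 0 ] * w + 2ℚ * ([ a ≐ c ] * W b (R d β) []) + 2ℚ * ([ a ≐ b ] * W c (R d β) [] + 2ℚ * ([ a ≐ b ℕ.+ c ] * R d β []))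
      + (- 1ℚ) * Wl (b ∷ c ∷ []) (R (d ℕ.+ a) β) []
      ≡⟨ cong₂ _+_ (cong₂ (λ x y → x + 2ℚ * y)
           (cong₂ (λ x y → x * w + 2ℚ * y) (≐-0 a l)
             (≐-guard a c (λ q → W-R¹ εb d β ld lβ (tail-sum a d β c b q (trans e (ℕₚ.+-comm b c))))))
           (cong₂ (λ x y → x + 2ℚ * ([ a ≐ b ℕ.+ c ] * y))
             (≐-guard a b (λ q → W-R¹ εc d β ld lβ (tail-sum a d β b c q e)))
             (R-at-[] d β ld)))
           (cong ((- 1ℚ) *_) (W-R² (d ℕ.+ a) β (ℕₚ.≤-trans ld (ℕₚ.m≤m+n d a)) lβ (trans (sum-merge a d β) e))) ⟩
    0ℚ * w + 2ℚ * ([ a ≐ c ] * (2ℚ * sgn β)) + 2ℚ * ([ a ≐ b ] * (2ℚ * sgn β) + 2ℚ * ([ a ≐ b ℕ.+ c ] * 0ℚ))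
      + (- 1ℚ) * (4ℚ * sgn β * (1ℚ - μ b (d ℕ.+ a) β - μ c (d ℕ.+ a) β))
      ≡⟨ p w [ a ≐ b ] [ a ≐ c ] [ a ≐ b ℕ.+ c ] (sgn β) (μ b (d ℕ.+ a) β) (μ c (d ℕ.+ a) β) ⟩
    4ℚ * (- sgn β) * (1ℚ - ([ a ≐ b ] + μ b (d ℕ.+ a) β) - ([ a ≐ c ] + μ c (d ℕ.+ a) β))
      ≡⟨ sym (cong₂ (λ x y → 4ℚ * (- sgn β) * (1ℚ - x - y)) (μ-cons b a d β ld) (μ-cons c a d β ld)) ⟩
    4ℚ * sgn (d ∷ β) * (1ℚ - μ b a (d ∷ β) - μ c a (d ∷ β)) ∎
    where
    w = W c (W b (R d β)) []
    p : ∀ w ib ic ibc s mb mc →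
        0ℚ * w + (1ℚ + 1ℚ) * (ic * ((1ℚ + 1ℚ) * s)) + (1ℚ + 1ℚ) * (ib * ((1ℚ + 1ℚ) * s) + (1ℚ + 1ℚ) * (ibc * 0ℚ))
        + (- 1ℚ) * ((1ℚ + 1ℚ) * (1ℚ + 1ℚ) * s * (1ℚ - mb - mc))
        ≡ (1ℚ + 1ℚ) * (1ℚ + 1ℚ) * (- s) * (1ℚ - (ib + mb) - (ic + mc))
    p = solve-∀ ℚring

-- A signed count of ordered set partitions of three indices: the blocks are the sets of operators
-- used up by successive merged rows, so the sum of each proper initial segment of blocks must be a
-- partial sum, and the sign is (-1)^(blocks - 1). Products such as `x * xy` are the partitions into
-- three blocks.
Z : ℚ → ℚ → ℚ → ℚ → ℚ → ℚ → ℚ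
Z x y z xy xz yz =
  1ℚ - x * (1ℚ - xy - xz) - y * (1ℚ - xy - yz) - z * (1ℚ - xz - yz) - xy - xz - yz

Zμ : ℕ → ℕ → ℕ → ℕ → List ℕ → ℚ
Zμ b c d a β = Z (m b) (m c) (m d) (m (b ℕ.+ c)) (m (b ℕ.+ d)) (m (c ℕ.+ d))
  where
  m : ℕ → ℚ
  m x = μ x a β

module _ {b c d} (εb : ε b ≡ 2ℚ) (εc : ε c ≡ 2ℚ) (εd : ε d ≡ 2ℚ) (1≤b : 1 ≤ b) (1≤c : 1 ≤ c) (1≤d : 1 ≤ d) where

  private
    -- If a = x + y then x lies strictly below `a`, the least partial sum.
    disjoint : ∀ a r β x y → 1 ≤ y → [ a ≐ x ℕ.+ y ] * ([ a ≐ x ] + μ x (r ℕ.+ a) β) ≡ 0ℚ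
    disjoint a r β x y l = trans (≐-guard a (x ℕ.+ y) {y = 0ℚ} λ e →
      let x<a = subst (x <_) (sym e) (ℕₚ.m<m+n x l) in
      cong₂ (λ s t → ι s + ι t) (≡ᵇ-false {a} {x} (λ q → ℕₚ.<⇒≢ x<a (sym q)))
            (mem-below x (r ℕ.+ a) β (ℕₚ.<-≤-trans x<a (ℕₚ.m≤n+m a r))))
      (ℚₚ.*-zeroʳ [ a ≐ x ℕ.+ y ])

    -- After a top row of length x has been split off, y is a partial sum of the rest exactly when x
    -- + y is one of the whole.
    shift : ∀ a r β x y → a ≡ x → μ y r β ≡ μ (x ℕ.+ y) (r ℕ.+ a) β
    shift a r β x y refl = cong ι (sym (mem-shift x y r β))

  -- The factor q_a must use up a nonempty set of operators with sum `a`. The one or two left over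
  -- are evaluated on the remaining rows by `W-R²` or `W-R¹`, and if none is left the remaining rows
  -- give constant term 0. The glued ribbon is the induction hypothesis; by `μ-cons` its partial
  -- sums are those of the whole without `a`.
  W-R³ : ∀ a β → 1 ≤ a → All (1 ≤_) β → a ℕ.+ sum β ≡ b ℕ.+ c ℕ.+ d →
         Wl (b ∷ c ∷ d ∷ []) (R a β) [] ≡ 8ℚ * sgn β * Zμ b c d a β
  W-R³ a [] l _ e =
    trans (Wl-Q⁻ a 0 one one-ZI {b ∷ c ∷ d ∷ []} (εb ∷ εc ∷ εd ∷ []))
    (trans (cong₂ _+_
       (cong₂ _+_ (cong₂ (λ x y → [ a ≐ 0 ] * x + 2ℚ * ([ a ≐ d ] * y)) (zero³ d (W c (W b one)) (zero² c b)) (zero² c b []))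
                  (cong₂ (λ x y → 2ℚ * ([ a ≐ c ] * x + 2ℚ * ([ a ≐ c ℕ.+ d ] * y))) (zero² d b []) (W-one b [])))
       (cong (2ℚ *_) (cong₂ _+_
          (cong₂ (λ x y → [ a ≐ b ] * x + 2ℚ * ([ a ≐ b ℕ.+ d ] * y)) (zero² d c []) (W-one c []))
          (cong₂ (λ x y → 2ℚ * ([ a ≐ b ℕ.+ c ] * x + 2ℚ * (ι y * 1ℚ))) (W-one d [])
            (≡ᵇ-true (trans (sym (ℕₚ.+-identityʳ a)) e))))))
      (p [ a ≐ 0 ] [ a ≐ b ] [ a ≐ c ] [ a ≐ d ] [ a ≐ b ℕ.+ c ] [ a ≐ b ℕ.+ d ] [ a ≐ c ℕ.+ d ]))
    where
    zero³ : ∀ x f → f ≈ 𝟘 → W x f [] ≡ 0ℚ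
    zero³ x f e = trans (lin-cong (W-linear x) f 𝟘 e []) (lin-𝟘 (W-linear x) [])
    zero² : ∀ x y → W x (W y one) ≈ 𝟘
    zero² x y a = trans (lin-cong (W-linear x) (W y one) 𝟘 (W-one y) a) (lin-𝟘 (W-linear x) a)
    p : ∀ o b c d bc bd cd →
        o * 0ℚ + (1ℚ + 1ℚ) * (d * 0ℚ) + (1ℚ + 1ℚ) * (c * 0ℚ + (1ℚ + 1ℚ) * (cd * 0ℚ)) +
        (1ℚ + 1ℚ) * (b * 0ℚ + (1ℚ + 1ℚ) * (bd * 0ℚ) + (1ℚ + 1ℚ) * (bc * 0ℚ + (1ℚ + 1ℚ) * (1ℚ * 1ℚ)))
        ≡ (1ℚ + 1ℚ) * ((1ℚ + 1ℚ) * (1ℚ + 1ℚ)) * 1ℚ *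
          (1ℚ - 0ℚ * (1ℚ - 0ℚ - 0ℚ) - 0ℚ * (1ℚ - 0ℚ - 0ℚ) - 0ℚ * (1ℚ - 0ℚ - 0ℚ) - 0ℚ - 0ℚ - 0ℚ)
    p = solve-∀ ℚring
  W-R³ a (r ∷ β) l (lr ∷ lβ) e = begin
    Wl (b ∷ c ∷ d ∷ []) (R a (r ∷ β)) []
      ≡⟨ Wl-R a r β {b ∷ c ∷ d ∷ []} (εb ∷ εc ∷ εd ∷ []) ⟩
    [ a ≐ 0 ] * w + 2ℚ * (i d * Wl (b ∷ c ∷ []) g [])
      + 2ℚ * (i c * Wl (b ∷ d ∷ []) g [] + 2ℚ * (i (c ℕ.+ d) * W b g []))
      + 2ℚ * (i b * Wl (c ∷ d ∷ []) g [] + 2ℚ * (i (b ℕ.+ d) * W c g [])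
              + 2ℚ * (i (b ℕ.+ c) * W d g [] + 2ℚ * (i (b ℕ.+ c ℕ.+ d) * g [])))
      + (- 1ℚ) * Wl (b ∷ c ∷ d ∷ []) (R (r ℕ.+ a) β) []
      ≡⟨ cong₂ _+_
          (cong₂ _+_
            (cong₂ _+_ (cong₂ (λ x y → x * w + 2ℚ * y) (≐-0 a l) (pair d b c εb εc (trans e (ℕₚ.+-comm (b ℕ.+ c) d))))
                       (cong₂ (λ x y → 2ℚ * (x + 2ℚ * y)) (pair c b d εb εd sum-c) (single b (c ℕ.+ d) εb sum-b)))
            (cong (2ℚ *_) (cong₂ _+_
              (cong₂ (λ x y → x + 2ℚ * y) (pair b c d εc εd (trans e (ℕₚ.+-assoc b c d)))
                                          (single c (b ℕ.+ d) εc (trans sum-c (ℕₚ.+-comm c (b ℕ.+ d)))))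
              (cong₂ (λ x y → 2ℚ * (x + 2ℚ * (i (b ℕ.+ c ℕ.+ d) * y))) (single d (b ℕ.+ c) εd e) (R-at-[] r β lr)))))
          (cong ((- 1ℚ) *_) (W-R³ (r ℕ.+ a) β (ℕₚ.≤-trans lr (ℕₚ.m≤m+n r a)) lβ (trans (sum-merge a r β) e))) ⟩
    0ℚ * w + 2ℚ * (i d * (4ℚ * s * (1ℚ - m (d ℕ.+ b) - m (d ℕ.+ c))))
      + 2ℚ * (i c * (4ℚ * s * (1ℚ - m (c ℕ.+ b) - m (c ℕ.+ d))) + 2ℚ * (i (c ℕ.+ d) * (2ℚ * s)))
      + 2ℚ * (i b * (4ℚ * s * (1ℚ - m (b ℕ.+ c) - m (b ℕ.+ d))) + 2ℚ * (i (b ℕ.+ d) * (2ℚ * s))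
              + 2ℚ * (i (b ℕ.+ c) * (2ℚ * s) + 2ℚ * (i (b ℕ.+ c ℕ.+ d) * 0ℚ)))
      + (- 1ℚ) * (8ℚ * s * Zμ b c d (r ℕ.+ a) β)
      ≡⟨ cong₂ (λ x y → 0ℚ * w + 2ℚ * (i d * (4ℚ * s * x))
           + 2ℚ * (i c * (4ℚ * s * (1ℚ - y - m (c ℕ.+ d))) + 2ℚ * (i (c ℕ.+ d) * (2ℚ * s)))
           + 2ℚ * (i b * (4ℚ * s * (1ℚ - m (b ℕ.+ c) - m (b ℕ.+ d))) + 2ℚ * (i (b ℕ.+ d) * (2ℚ * s))
              + 2ℚ * (i (b ℕ.+ c) * (2ℚ * s) + 2ℚ * (i (b ℕ.+ c ℕ.+ d) * 0ℚ)))
           + (- 1ℚ) * (8ℚ * s * Zμ b c d (r ℕ.+ a) β))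
           (cong₂ (λ x y → 1ℚ - m x - m y) (ℕₚ.+-comm d b) (ℕₚ.+-comm d c)) (cong m (ℕₚ.+-comm c b)) ⟩
    _ ≡⟨ p w s (i (b ℕ.+ c ℕ.+ d)) (i b) (i c) (i d) (i (b ℕ.+ c)) (i (b ℕ.+ d)) (i (c ℕ.+ d))
           (m b) (m c) (m d) (m (b ℕ.+ c)) (m (b ℕ.+ d)) (m (c ℕ.+ d)) ⟩
    U (i (b ℕ.+ c) * (i b + m b)) (i (b ℕ.+ d) * (i b + m b)) (i (b ℕ.+ c) * (i c + m c))
      (i (c ℕ.+ d) * (i c + m c)) (i (b ℕ.+ d) * (i d + m d)) (i (c ℕ.+ d) * (i d + m d))
      ≡⟨ cong₂ (λ x y → x y) (cong₂ (λ x y → x y) (cong₂ (λ x y → x y) (cong₂ (λ x y → x y)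
           (cong₂ U (disjoint a r β b c 1≤c) (disjoint a r β b d 1≤d)) (swapped b c 1≤b)) (disjoint a r β c d 1≤d))
           (swapped b d 1≤b)) (swapped c d 1≤c) ⟩
    U 0ℚ 0ℚ 0ℚ 0ℚ 0ℚ 0ℚ
      ≡⟨ p' s Zi ⟩
    8ℚ * (- s) * Zi
      ≡⟨ cong (8ℚ * (- s) *_) (sym
           (cong₂ (λ x y → x y) (cong₂ (λ x y → x y) (cong₂ (λ x y → x y) (cong₂ (λ x y → x y)
             (cong₂ Z (cons b) (cons c)) (cons d)) (cons (b ℕ.+ c))) (cons (b ℕ.+ d))) (cons (c ℕ.+ d)))) ⟩
    8ℚ * sgn (r ∷ β) * Zμ b c d a (r ∷ β) ∎
    where
    g = R r β
    s = sgn β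
    w = W d (W c (W b g)) []
    i m : ℕ → ℚ
    i x = [ a ≐ x ]
    m x = μ x (r ℕ.+ a) β
    cons : ∀ x → μ x a (r ∷ β) ≡ i x + m x
    cons x = μ-cons x a r β lr
    Zi : ℚ
    Zi = Z (i b + m b) (i c + m c) (i d + m d)
           (i (b ℕ.+ c) + m (b ℕ.+ c)) (i (b ℕ.+ d) + m (b ℕ.+ d)) (i (c ℕ.+ d) + m (c ℕ.+ d))
    -- k₁, …, k₆ are the cross terms of Z that the recursion does not produce; by disjoint they vanish.
    U : ℚ → ℚ → ℚ → ℚ → ℚ → ℚ → ℚ
    U k₁ k₂ k₃ k₄ k₅ k₆ = (1ℚ + 1ℚ) * ((1ℚ + 1ℚ) * (1ℚ + 1ℚ)) * (- s) *
      (Zi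
       - (k₁ + k₂ + k₃ + k₄ + k₅ + k₆))
    swapped : ∀ x y → 1 ≤ x → i (x ℕ.+ y) * (i y + m y) ≡ 0ℚ
    swapped x y l = trans (cong (λ z → i z * (i y + m y)) (ℕₚ.+-comm x y)) (disjoint a r β y x l)
    sum-b : a ℕ.+ sum (r ∷ β) ≡ c ℕ.+ d ℕ.+ b
    sum-b = trans e (trans (ℕₚ.+-assoc b c d) (ℕₚ.+-comm b (c ℕ.+ d)))
    sum-c : a ℕ.+ sum (r ∷ β) ≡ c ℕ.+ (b ℕ.+ d)
    sum-c = trans e (trans (cong (ℕ._+ d) (ℕₚ.+-comm b c)) (ℕₚ.+-assoc c b d))
    single : ∀ x y → ε x ≡ 2ℚ → a ℕ.+ sum (r ∷ β) ≡ y ℕ.+ x → i y * W x g [] ≡ i y * (2ℚ * s)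
    single x y εx e = ≐-guard a y (λ q → W-R¹ εx r β lr lβ (tail-sum a r β y x q e))
    pair : ∀ x y z → ε y ≡ 2ℚ → ε z ≡ 2ℚ → a ℕ.+ sum (r ∷ β) ≡ x ℕ.+ (y ℕ.+ z) →
           i x * Wl (y ∷ z ∷ []) g [] ≡ i x * (4ℚ * s * (1ℚ - m (x ℕ.+ y) - m (x ℕ.+ z)))
    pair x y z εy εz e = ≐-guard a x λ q →
      trans (W-R² εy εz r β lr lβ (tail-sum a r β x (y ℕ.+ z) q e))
            (cong₂ (λ u v → 4ℚ * s * (1ℚ - u - v)) (shift a r β x y q) (shift a r β x z q))
    p' : ∀ s z → (1ℚ + 1ℚ) * ((1ℚ + 1ℚ) * (1ℚ + 1ℚ)) * (- s) * (z - (0ℚ + 0ℚ + 0ℚ + 0ℚ + 0ℚ + 0ℚ)) ≡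
         (1ℚ + 1ℚ) * ((1ℚ + 1ℚ) * (1ℚ + 1ℚ)) * (- s) * z
    p' = solve-∀ ℚring
    p : ∀ w s ibcd ib ic id ibc ibd icd mb mc md mbc mbd mcd →
      0ℚ * w + (1ℚ + 1ℚ) * (id * ((1ℚ + 1ℚ) * (1ℚ + 1ℚ) * s * (1ℚ - mbd - mcd)))
        + (1ℚ + 1ℚ) * (ic * ((1ℚ + 1ℚ) * (1ℚ + 1ℚ) * s * (1ℚ - mbc - mcd)) + (1ℚ + 1ℚ) * (icd * ((1ℚ + 1ℚ) * s)))
        + (1ℚ + 1ℚ) * (ib * ((1ℚ + 1ℚ) * (1ℚ + 1ℚ) * s * (1ℚ - mbc - mbd)) + (1ℚ + 1ℚ) * (ibd * ((1ℚ + 1ℚ) * s))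
              + (1ℚ + 1ℚ) * (ibc * ((1ℚ + 1ℚ) * s) + (1ℚ + 1ℚ) * (ibcd * 0ℚ)))
        + (- 1ℚ) * ((1ℚ + 1ℚ) * ((1ℚ + 1ℚ) * (1ℚ + 1ℚ)) * s *
            (1ℚ - mb * (1ℚ - mbc - mbd) - mc * (1ℚ - mbc - mcd) - md * (1ℚ - mbd - mcd) - mbc - mbd - mcd))
      ≡ (1ℚ + 1ℚ) * ((1ℚ + 1ℚ) * (1ℚ + 1ℚ)) * (- s) *
        ((1ℚ - (ib + mb) * (1ℚ - (ibc + mbc) - (ibd + mbd)) - (ic + mc) * (1ℚ - (ibc + mbc) - (icd + mcd))
             - (id + md) * (1ℚ - (ibd + mbd) - (icd + mcd)) - (ibc + mbc) - (ibd + mbd) - (icd + mcd))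
         - (ibc * (ib + mb) + ibd * (ib + mb) + ibc * (ic + mc) + icd * (ic + mc) + ibd * (id + md) + icd * (id + md)))
    p = solve-∀ ℚring

-- Tableaux of ribbon shape

-- the least letter allowed to the right of v in a row
next : ℕ → ℕ
next v = if isMarked v then suc v else v

-- Equal letters are allowed in a row when unmarked and in a column when marked, so with the pair
-- reversed the column condition is exactly the negation of the row condition. The gluing of rows
-- rests on this complementarity.
okRow okCol : ℕ → ℕ → Bool
okRow v w = next v ≤ᵇ w
okCol v w = not (okRow w v)

≤-next : ∀ v → v ≤ next v
≤-next v with isMarked v
... | true = ℕₚ.n≤1+n v
... | false = ℕₚ.≤-refl

next-≤ : ∀ v → next v ≤ suc v
next-≤ v with isMarked v
... | true = ℕₚ.≤-refl
... | false = ℕₚ.n≤1+n v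

okRow⇒ : ∀ v w → okRow v w ≡ true → next v ≤ w
okRow⇒ v w e = ℕₚ.≤ᵇ⇒≤ (next v) w (subst T (sym e) _)

okCol⇒ : ∀ v w → okCol v w ≡ true → v < next w
okCol⇒ v w e with next w ≤ᵇ v in q
... | false = ℕₚ.≰⇒> (λ l → subst T (trans (sym (≤ᵇ-true l)) q) _)

okCol⇐ : ∀ v w → v < next w → okCol v w ≡ true
okCol⇐ v w l = cong not (≤ᵇ-false l)

okRow-trans : ∀ u v w → okRow u v ≡ true → okRow v w ≡ true → okRow u w ≡ true
okRow-trans u v w p q = ≤ᵇ-true (ℕₚ.≤-trans (okRow⇒ u v p) (ℕₚ.≤-trans (≤-next v) (okRow⇒ v w q)))

okCol-trans : ∀ u v w → okCol u v ≡ true → okCol v w ≡ true → okCol u w ≡ true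
okCol-trans u v w p q =
  okCol⇐ u w (ℕₚ.≤-<-trans (ℕₚ.≤-pred (ℕₚ.<-≤-trans (okCol⇒ u v p) (next-≤ v))) (okCol⇒ v w q))

okRow-spec : ∀ v w → ((v ≤ᵇ w) ∧ not ((v ≡ᵇ w) ∧ isMarked v)) ≡ okRow v w
okRow-spec v w with isMarked v
... | true = trans (cong (λ b → (v ≤ᵇ w) ∧ not b) (∧-identityʳ (v ≡ᵇ w))) (strict v w)
  where
  <ᵇ-suc : ∀ v w → (v <ᵇ suc w) ≡ (v ≤ᵇ w)
  <ᵇ-suc zero w = refl
  <ᵇ-suc (suc v) w = refl
  strict : ∀ v w → ((v ≤ᵇ w) ∧ not (v ≡ᵇ w)) ≡ (v <ᵇ w)
  strict zero zero = refl
  strict zero (suc w) = refl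
  strict (suc v) zero = refl
  strict (suc v) (suc w) = trans (cong (_∧ not (v ≡ᵇ w)) (<ᵇ-suc v w)) (strict v w)
... | false = trans (cong (λ b → (v ≤ᵇ w) ∧ not b) (∧-zeroʳ (v ≡ᵇ w))) (∧-identityʳ (v ≤ᵇ w))

okCol-spec : ∀ v w → ((v ≤ᵇ w) ∧ not ((v ≡ᵇ w) ∧ not (isMarked v))) ≡ okCol v w
okCol-spec v w with ℕₚ.<-cmp v w
... | tri< l ne _ = trans (cong₂ (λ x y → x ∧ not (y ∧ not (isMarked v))) (≤ᵇ-true (ℕₚ.<⇒≤ l)) (≡ᵇ-false ne))
                          (sym (okCol⇐ v w (ℕₚ.<-≤-trans l (≤-next w))))
... | tri≈ _ refl _ = trans (cong₂ (λ x y → x ∧ not (y ∧ not (isMarked v))) (≤ᵇ-true (ℕₚ.≤-refl {v})) (≡ᵇ-true {v} refl)) diagonal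
  where
  diagonal : not (not (isMarked v)) ≡ okCol v v
  diagonal with isMarked v
  ... | true = cong not (sym (≤ᵇ-false (ℕₚ.n<1+n v)))
  ... | false = cong not (sym (≤ᵇ-true (ℕₚ.≤-refl {v})))
... | tri> _ ne l = trans (cong (_∧ not ((v ≡ᵇ w) ∧ not (isMarked v))) (≤ᵇ-false l))
                          (cong not (sym (≤ᵇ-true (ℕₚ.≤-trans (next-≤ w) l))))

pairOK-row : ∀ r {c₁ c₂} v w → c₁ < c₂ → pairOK ((r , c₁) , v) ((r , c₂) , w) ≡ okRow v w
pairOK-row r {c₁} {c₂} v w l
  rewrite ≡ᵇ-true {r} refl | ≡ᵇ-false (ℕₚ.<⇒≢ l) | ≤ᵇ-true (ℕₚ.<⇒≤ l) | ≤ᵇ-false l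
  = trans (∧-identityʳ _) (okRow-spec v w)

pairOK-col : ∀ {r₁ r₂} c v w → r₁ < r₂ → pairOK ((r₁ , c) , v) ((r₂ , c) , w) ≡ okCol v w
pairOK-col {r₁} {r₂} c v w l
  rewrite ≡ᵇ-true {c} refl | ≡ᵇ-false (ℕₚ.<⇒≢ l) | ≤ᵇ-true (ℕₚ.<⇒≤ l) | ≤ᵇ-false l
  = okCol-spec v w

pairOK-far : ∀ {r₁ r₂ c₁ c₂} v w → r₁ < r₂ → c₁ ≢ c₂ → pairOK ((r₁ , c₁) , v) ((r₂ , c₂) , w) ≡ true
pairOK-far v w l ne rewrite ≡ᵇ-false (ℕₚ.<⇒≢ l) | ≡ᵇ-false ne = refl

row : ℕ → ℕ → List ℕ → List (Box × ℕ)
row r c [] = []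
row r c (v ∷ w) = ((r , c) , v) ∷ row r (suc c) w

cols : List (List ℕ) → ℕ
cols ws = sum (map (_∸ 1) (map length ws))

entries : ℕ → List (List ℕ) → List (Box × ℕ)
entries r [] = []
entries r (w ∷ ws) = row r (suc (cols ws)) w ++ entries (suc r) ws

zip-row : ∀ r s s' g w D f → (∀ c → s ℕ.+ g c ≡ s' ℕ.+ c) →
  zip (map (λ c → (r , s ℕ.+ c)) (applyUpTo g (length w)) ++ D) (w ++ f) ≡ row r s' w ++ zip D f
zip-row r s s' g [] D f e = refl
zip-row r s s' g (v ∷ w) D f e = cong₂ _∷_ (cong (λ z → ((r , z) , v)) (trans (e 0) (ℕₚ.+-identityʳ s')))
  (zip-row r s (suc s') (g ∘ suc) w D f (λ c → trans (e (suc c)) (ℕₚ.+-suc s' c)))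

zip-ribbon : ∀ r ws → zip (ribbonRows r (map length ws)) (concat ws) ≡ entries r ws
zip-ribbon r [] = refl
zip-ribbon r (w ∷ ws) =
  trans (zip-row r (suc (cols ws)) (suc (cols ws)) id w (ribbonRows (suc r) (map length ws)) (concat ws) (λ _ → refl))
        (cong (row r (suc (cols ws)) w ++_) (zip-ribbon (suc r) ws))

-- The unmarked code 0 puts no constraint on what follows.
rowFrom : ℕ → List ℕ → Bool
rowFrom v [] = true
rowFrom v (u ∷ w) = okRow v u ∧ rowFrom u w

firstOf : List ℕ → ℕ
firstOf [] = 0
firstOf (v ∷ _) = v

valid : List (List ℕ) → Bool
valid [] = true
valid (w ∷ []) = rowFrom 0 w
valid (w ∷ ws@(w' ∷ _)) = rowFrom 0 w ∧ okCol (firstOf w) (lastOf 0 w') ∧ valid ws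

∧-absorb : ∀ {x y z} → (z ≡ true → x ≡ y) → x ∧ z ≡ y ∧ z
∧-absorb {x} {y} {true} h = cong (_∧ true) (h refl)
∧-absorb {x} {y} {false} h = trans (∧-zeroʳ x) (sym (∧-zeroʳ y))

∧-true : ∀ {x y} → x ∧ y ≡ true → x ≡ true × y ≡ true
∧-true {true} {true} _ = refl , refl

all-++ : ∀ {A : Set} (p : A → Bool) xs ys → all p (xs ++ ys) ≡ all p xs ∧ all p ys
all-++ p [] ys = refl
all-++ p (x ∷ xs) ys = trans (cong (p x ∧_) (all-++ p xs ys)) (sym (∧-assoc (p x) _ _))

row-right : ∀ r c₀ c v u w → c₀ < c → okRow v u ≡ true → rowFrom u w ≡ true →
            all (pairOK ((r , c₀) , v)) (row r c w) ≡ true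
row-right r c₀ c v u [] l o p = refl
row-right r c₀ c v u (x ∷ w) l o p = let (q , p') = ∧-true {okRow u x} p ; o' = okRow-trans v u x o q in
  cong₂ _∧_ (trans (pairOK-row r v x l) o') (row-right r c₀ (suc c) v x w (ℕₚ.m≤n⇒m≤1+n l) o' p')

row-valid : ∀ r c₀ c v w → c₀ < c →
            all (pairOK ((r , c₀) , v)) (row r c w) ∧ allPairsOK (row r c w) ≡ rowFrom v w
row-valid r c₀ c v [] l = refl
row-valid r c₀ c v (u ∷ w) l = begin
  (pairOK ((r , c₀) , v) ((r , c) , u) ∧ A) ∧ (all (pairOK ((r , c) , u)) (row r (suc c) w) ∧ allPairsOK (row r (suc c) w))
    ≡⟨ cong₂ (λ x y → (x ∧ A) ∧ y) (pairOK-row r v u l) (row-valid r c (suc c) u w ℕₚ.≤-refl) ⟩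
  (okRow v u ∧ A) ∧ rowFrom u w
    ≡⟨ ∧-absorb (λ p → absorb (okRow v u) refl p) ⟩
  okRow v u ∧ rowFrom u w ∎
  where
  A = all (pairOK ((r , c₀) , v)) (row r (suc c) w)
  absorb : ∀ b → okRow v u ≡ b → rowFrom u w ≡ true → b ∧ A ≡ b
  absorb true o p = row-right r c₀ (suc c) v u w (ℕₚ.m≤n⇒m≤1+n l) o p
  absorb false o p = refl

allPairs-row : ∀ r c w → allPairsOK (row r c w) ≡ rowFrom 0 w
allPairs-row r c [] = refl
allPairs-row r c (v ∷ w) = row-valid r c (suc c) v w ℕₚ.≤-refl

allPairs-++ : ∀ X Y → allPairsOK (X ++ Y) ≡ allPairsOK X ∧ (all (λ e → all (pairOK e) Y) X ∧ allPairsOK Y)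
allPairs-++ [] Y = refl
allPairs-++ (e ∷ X) Y = trans (cong₂ _∧_ (all-++ (pairOK e) X Y) (allPairs-++ X Y))
  (shuffle (all (pairOK e) X) (all (pairOK e) Y) (allPairsOK X) _ _)
  where
  shuffle : ∀ a b c d f → (a ∧ b) ∧ (c ∧ (d ∧ f)) ≡ (a ∧ c) ∧ ((b ∧ d) ∧ f)
  shuffle false b c d f = refl
  shuffle true false false d f = refl
  shuffle true false true d f = refl
  shuffle true true c d f = refl

NonEmpty : List ℕ → Set
NonEmpty w = 1 ≤ length w

module _ {r₀ : ℕ} {v : ℕ} where

  row-left : ∀ c₀ r c w → r₀ < r → c ℕ.+ length w ≤ c₀ → all (pairOK ((r₀ , c₀) , v)) (row r c w) ≡ true
  row-left c₀ r c [] l h = refl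
  row-left c₀ r c (u ∷ w) l h =
    let h' = subst (_≤ c₀) (ℕₚ.+-suc c (length w)) h in
    cong₂ _∧_ (pairOK-far v u l (λ e → ℕₚ.<⇒≢ (ℕₚ.≤-trans (s≤s (ℕₚ.m≤m+n c (length w))) h') (sym e)))
              (row-left c₀ r (suc c) w l h')

  rows-left : ∀ c₀ r ws → All NonEmpty ws → r₀ < r → suc (cols ws) < c₀ → all (pairOK ((r₀ , c₀) , v)) (entries r ws) ≡ true
  rows-left c₀ r [] ne l h = refl
  rows-left c₀ r ((u ∷ w) ∷ ws) (_ ∷ ne) l h =
    trans (all-++ (pairOK ((r₀ , c₀) , v)) (row r (suc (cols ws)) (u ∷ w)) (entries (suc r) ws))
    (cong₂ _∧_
      (row-left c₀ r (suc (cols ws)) (u ∷ w) l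
        (subst (_≤ c₀) (cong suc (trans (cong suc (ℕₚ.+-comm (length w) (cols ws))) (sym (ℕₚ.+-suc (cols ws) (length w))))) h))
      (rows-left c₀ (suc r) ws ne (ℕₚ.m≤n⇒m≤1+n l) (ℕₚ.≤-<-trans (s≤s (ℕₚ.m≤n+m (cols ws) (length w))) h)))

  row-last : ∀ r c u w → r₀ < r → all (pairOK ((r₀ , c ℕ.+ length w) , v)) (row r c (u ∷ w)) ≡ okCol v (lastOf u w)
  row-last r c u [] l = trans (∧-identityʳ _)
    (trans (cong (λ z → pairOK ((r₀ , z) , v) ((r , c) , u)) (ℕₚ.+-identityʳ c)) (pairOK-col c v u l))
  row-last r c u (x ∷ w) l = trans
    (cong₂ _∧_ (pairOK-far v u l (λ e → ℕₚ.m+1+n≢m c e))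
               (cong (λ z → all (pairOK ((r₀ , z) , v)) (row r (suc c) (x ∷ w))) (ℕₚ.+-suc c (length w))))
    (row-last r (suc c) x w l)

mutual
  -- The new box stands over the right end of `w`. Its column goes on below `w` only if `w` is a
  -- single box, and then validity of the lower rows and transitivity of the column condition settle
  -- the further comparisons.
  above-ribbon : ∀ {r₀ v} r w ws → All NonEmpty (w ∷ ws) → r₀ < r → valid (w ∷ ws) ≡ true →
    all (pairOK ((r₀ , suc (cols (w ∷ ws))) , v)) (entries r (w ∷ ws)) ≡ okCol v (lastOf 0 w)
  above-ribbon {r₀} {v} r (u ∷ w) ws (n ∷ ne) l p =
    trans (all-++ (pairOK ((r₀ , suc (cols ((u ∷ w) ∷ ws))) , v)) (row r (suc (cols ws)) (u ∷ w)) (entries (suc r) ws))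
    (trans (cong (_∧ all (pairOK ((r₀ , suc (cols ((u ∷ w) ∷ ws))) , v)) (entries (suc r) ws))
             (trans (cong (λ z → all (pairOK ((r₀ , z) , v)) (row r (suc (cols ws)) (u ∷ w)))
                          (cong suc (ℕₚ.+-comm (length w) (cols ws))))
                    (row-last r (suc (cols ws)) u w l)))
           (absorb (okCol v (lastOf u w)) refl))
    where
    absorb : ∀ b → okCol v (lastOf u w) ≡ b →
             b ∧ all (pairOK ((r₀ , suc (cols ((u ∷ w) ∷ ws))) , v)) (entries (suc r) ws) ≡ b
    absorb true o = lower-rows r u w ws (n ∷ ne) l p o
    absorb false o = refl

  lower-rows : ∀ {r₀ v} r u w ws → All NonEmpty ((u ∷ w) ∷ ws) → r₀ < r → valid ((u ∷ w) ∷ ws) ≡ true →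
    okCol v (lastOf u w) ≡ true →
    all (pairOK ((r₀ , suc (cols ((u ∷ w) ∷ ws))) , v)) (entries (suc r) ws) ≡ true
  lower-rows r u w [] ne l p o = refl
  lower-rows {v = v} r u [] (w' ∷ ws) (_ ∷ ne) l p o =
    let (_ , p') = ∧-true {rowFrom 0 (u ∷ [])} p
        (q , p'') = ∧-true {okCol u (lastOf 0 w')} p'
    in trans (above-ribbon (suc r) w' ws ne (ℕₚ.m≤n⇒m≤1+n l) p'') (okCol-trans v u (lastOf 0 w') o q)
  lower-rows r u (x ∷ w) (w' ∷ ws) (_ ∷ ne) l p o =
    rows-left _ (suc r) (w' ∷ ws) ne (ℕₚ.m≤n⇒m≤1+n l) (s≤s (s≤s (ℕₚ.m≤n+m (cols (w' ∷ ws)) (length w))))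

cross-tail : ∀ r c w ws → All NonEmpty ws → suc (cols ws) < c →
             all (λ e → all (pairOK e) (entries (suc r) ws)) (row r c w) ≡ true
cross-tail r c [] ws ne l = refl
cross-tail r c (v ∷ w) ws ne l =
  cong₂ _∧_ (rows-left c (suc r) ws ne ℕₚ.≤-refl l) (cross-tail r (suc c) w ws ne (ℕₚ.m≤n⇒m≤1+n l))

-- Of the top row only the leftmost box has boxes beneath it, so `above-ribbon` handles that one;
-- the others lie to the right of everything below (`cross-tail`).
isTableau-valid : ∀ r ws → All NonEmpty ws → allPairsOK (entries r ws) ≡ valid ws
isTableau-valid r [] ne = refl
isTableau-valid r (w ∷ []) (_ ∷ []) =
  trans (allPairs-++ (row r 1 w) []) (trans (cong₂ _∧_ (allPairs-row r 1 w) (no-cross (row r 1 w))) (∧-identityʳ _))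
  where
  no-cross : ∀ X → all (λ e → all (pairOK e) []) X ∧ true ≡ true
  no-cross [] = refl
  no-cross (_ ∷ X) = no-cross X
isTableau-valid r ((v ∷ w) ∷ ws@(w' ∷ ws')) (_ ∷ ne) =
  trans (allPairs-++ (row r (suc (cols ws)) (v ∷ w)) (entries (suc r) ws))
  (cong₂ _∧_ (allPairs-row r (suc (cols ws)) (v ∷ w))
    (trans (cong₂ _∧_ (trans (cong (all (pairOK ((r , suc (cols ws)) , v)) (entries (suc r) ws) ∧_)
                                    (cross-tail r (suc (suc (cols ws))) w ws ne ℕₚ.≤-refl)) (∧-identityʳ _))
                      (isTableau-valid (suc r) ws ne))
           -- `above-ribbon` assumes valid lower rows; the last conjunct provides this.
           (∧-absorb (above-ribbon (suc r) w' ws' ne ℕₚ.≤-refl))))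

-- Generating functions of ribbon tableaux

countB-++ : ∀ {A : Set} (p : A → Bool) xs ys → countB p (xs ++ ys) ≡ countB p xs ℕ.+ countB p ys
countB-++ p [] ys = refl
countB-++ p (x ∷ xs) ys with p x
... | true = cong suc (countB-++ p xs ys)
... | false = countB-++ p xs ys

∑ : ℕ → (ℕ → ℚ) → ℚ
∑ zero h = 0ℚ
∑ (suc K) h = h 0 + ∑ K (h ∘ suc)

∑-cong : ∀ K {h h'} → (∀ i → h i ≡ h' i) → ∑ K h ≡ ∑ K h'
∑-cong zero e = refl
∑-cong (suc K) e = cong₂ _+_ (e 0) (∑-cong K (e ∘ suc))

∑-0 : ∀ K → ∑ K (λ _ → 0ℚ) ≡ 0ℚ
∑-0 zero = refl
∑-0 (suc K) = trans (ℚₚ.+-identityˡ _) (∑-0 K)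

∑-lin : ∀ K h h' c → ∑ K (λ i → h i + c * h' i) ≡ ∑ K h + c * ∑ K h'
∑-lin zero h h' c = zero-lin c
∑-lin (suc K) h h' c = trans (cong ((h 0 + c * h' 0) +_) (∑-lin K (h ∘ suc) (h' ∘ suc) c))
  (interchange (h 0) (h' 0) (∑ K (h ∘ suc)) (∑ K (h' ∘ suc)) c)

module _ (K : ℕ) where

  wordSum : ℕ → (List ℕ → ℚ) → ℚ
  wordSum zero φ = φ []
  wordSum (suc n) φ = ∑ K (λ i → wordSum n (λ w → φ (suc i ∷ w)))

  wordSum-cong : ∀ n {φ ψ} → (∀ w → length w ≡ n → φ w ≡ ψ w) → wordSum n φ ≡ wordSum n ψ
  wordSum-cong zero e = e [] refl
  wordSum-cong (suc n) e = ∑-cong K (λ i → wordSum-cong n (λ w l → e (suc i ∷ w) (cong suc l)))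

  wordSum-lin : ∀ n φ ψ c → wordSum n (λ w → φ w + c * ψ w) ≡ wordSum n φ + c * wordSum n ψ
  wordSum-lin zero φ ψ c = refl
  wordSum-lin (suc n) φ ψ c = trans (∑-cong K (λ i → wordSum-lin n (λ w → φ (suc i ∷ w)) (λ w → ψ (suc i ∷ w)) c))
    (∑-lin K (λ i → wordSum n (λ w → φ (suc i ∷ w))) (λ i → wordSum n (λ w → ψ (suc i ∷ w))) c)

  wordSum-0 : ∀ n → wordSum n (λ _ → 0ℚ) ≡ 0ℚ
  wordSum-0 zero = refl
  wordSum-0 (suc n) = trans (∑-cong K (λ _ → wordSum-0 n)) (∑-0 K)

  wordSum-scale : ∀ n φ c → wordSum n (λ w → c * φ w) ≡ c * wordSum n φ
  wordSum-scale n φ c = trans (wordSum-cong n (λ w _ → sym (ℚₚ.+-identityˡ (c * φ w))))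
    (trans (wordSum-lin n (λ _ → 0ℚ) φ c) (trans (cong (_+ c * wordSum n φ) (wordSum-0 n)) (ℚₚ.+-identityˡ _)))

  wordSum-++ : ∀ m n φ → wordSum (m ℕ.+ n) φ ≡ wordSum m (λ u → wordSum n (λ v → φ (u ++ v)))
  wordSum-++ zero n φ = refl
  wordSum-++ (suc m) n φ = ∑-cong K (λ i → wordSum-++ m n (λ w → φ (suc i ∷ w)))

  wordSum-∑ : ∀ n M (φ : ℕ → List ℕ → ℚ) → wordSum n (λ w → ∑ M (λ i → φ i w)) ≡ ∑ M (λ i → wordSum n (φ i))
  wordSum-∑ n zero φ = wordSum-0 n
  wordSum-∑ n (suc M) φ = begin
    wordSum n (λ w → φ 0 w + ∑ M (λ i → φ (suc i) w))
      ≡⟨ wordSum-cong n (λ w _ → cong (φ 0 w +_) (sym (ℚₚ.*-identityˡ _))) ⟩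
    wordSum n (λ w → φ 0 w + 1ℚ * ∑ M (λ i → φ (suc i) w))
      ≡⟨ wordSum-lin n (φ 0) (λ w → ∑ M (λ i → φ (suc i) w)) 1ℚ ⟩
    wordSum n (φ 0) + 1ℚ * wordSum n (λ w → ∑ M (λ i → φ (suc i) w))
      ≡⟨ cong (wordSum n (φ 0) +_) (trans (ℚₚ.*-identityˡ _) (wordSum-∑ n M (φ ∘ suc))) ⟩
    wordSum n (φ 0) + ∑ M (λ i → wordSum n (φ (suc i))) ∎

  wordSum-swap : ∀ m n (φ : List ℕ → List ℕ → ℚ) → wordSum m (λ u → wordSum n (λ v → φ u v)) ≡ wordSum n (λ v → wordSum m (λ u → φ u v))
  wordSum-swap zero n φ = refl
  wordSum-swap (suc m) n φ = trans (∑-cong K (λ i → wordSum-swap m n (λ u → φ (suc i ∷ u))))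
    (sym (wordSum-∑ n K (λ i v → wordSum m (λ u → φ (suc i ∷ u) v))))

  wordSum-op : ∀ {O} → Linear O → ∀ n (φ : List ℕ → Fn) A → wordSum n (λ w → O (φ w) A) ≡ O (λ A' → wordSum n (λ w → φ w A')) A
  wordSum-op lin zero φ A = refl
  wordSum-op {O} lin (suc n) φ A = trans (∑-cong K (λ i → wordSum-op lin n (λ w → φ (suc i ∷ w)) A))
                                    (∑-op K (λ i A' → wordSum n (λ w → φ (suc i ∷ w) A')))
    where
    ∑-op : ∀ M (ψ : ℕ → Fn) → ∑ M (λ i → O (ψ i) A) ≡ O (λ A' → ∑ M (λ i → ψ i A')) A
    ∑-op zero ψ = sym (lin-𝟘 lin A)
    ∑-op (suc M) ψ = trans (cong (O (ψ 0) A +_) (∑-op M (ψ ∘ suc)))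
      (sym (lin-⊕ lin (ψ 0) (λ A' → ∑ M (λ i → ψ (suc i) A')) A))

  tupleSum : List ℕ → (List (List ℕ) → ℚ) → ℚ
  tupleSum [] Φ = Φ []
  tupleSum (a ∷ α) Φ = wordSum a (λ w → tupleSum α (λ ws → Φ (w ∷ ws)))

  tupleSum-cong : ∀ α {Φ Ψ} → (∀ ws → map length ws ≡ α → Φ ws ≡ Ψ ws) → tupleSum α Φ ≡ tupleSum α Ψ
  tupleSum-cong [] e = e [] refl
  tupleSum-cong (a ∷ α) e = wordSum-cong a (λ w l → tupleSum-cong α (λ ws l' → e (w ∷ ws) (cong₂ _∷_ l l')))

  tupleSum-lin : ∀ α Φ Ψ c → tupleSum α (λ ws → Φ ws + c * Ψ ws) ≡ tupleSum α Φ + c * tupleSum α Ψ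
  tupleSum-lin [] Φ Ψ c = refl
  tupleSum-lin (a ∷ α) Φ Ψ c = trans (wordSum-cong a (λ w _ → tupleSum-lin α (λ ws → Φ (w ∷ ws)) (λ ws → Ψ (w ∷ ws)) c))
    (wordSum-lin a (λ w → tupleSum α (λ ws → Φ (w ∷ ws))) (λ w → tupleSum α (λ ws → Ψ (w ∷ ws))) c)

  tupleSum-scale : ∀ α Φ c → tupleSum α (λ ws → c * Φ ws) ≡ c * tupleSum α Φ
  tupleSum-scale [] Φ c = refl
  tupleSum-scale (a ∷ α) Φ c = trans (wordSum-cong a (λ w _ → tupleSum-scale α (λ ws → Φ (w ∷ ws)) c))
    (wordSum-scale a (λ w → tupleSum α (λ ws → Φ (w ∷ ws))) c)

  tupleSum-op : ∀ {O} → Linear O → ∀ α (Φ : List (List ℕ) → Fn) A →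
           tupleSum α (λ ws → O (Φ ws) A) ≡ O (λ A' → tupleSum α (λ ws → Φ ws A')) A
  tupleSum-op lin [] Φ A = refl
  tupleSum-op lin (a ∷ α) Φ A = trans (wordSum-cong a (λ w _ → tupleSum-op lin α (λ ws → Φ (w ∷ ws)) A))
    (wordSum-op lin a (λ w A' → tupleSum α (λ ws → Φ (w ∷ ws) A')) A)

  wordSum-concat : ∀ α φ → wordSum (sum α) φ ≡ tupleSum α (φ ∘ concat)
  wordSum-concat [] φ = refl
  wordSum-concat (a ∷ α) φ = trans (wordSum-++ a (sum α) φ) (wordSum-cong a (λ w _ → wordSum-concat α (λ f → φ (w ++ f))))

  countB-wordSum : ∀ n (p : List ℕ → Bool) → toℚ (countB p (allLists n K)) ≡ wordSum n (ι ∘ p)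
  countB-wordSum zero p with p []
  ... | true = refl
  ... | false = refl
  countB-wordSum (suc n) p = go K suc
    where
    count-map : ∀ v xs → countB p (map (v ∷_) xs) ≡ countB (λ w → p (v ∷ w)) xs
    count-map v [] = refl
    count-map v (x ∷ xs) with p (v ∷ x)
    ... | true = cong suc (count-map v xs)
    ... | false = count-map v xs
    go : ∀ M (g : ℕ → ℕ) → toℚ (countB p (concatMap (λ v → map (v ∷_) (allLists n K)) (applyUpTo g M))) ≡
         ∑ M (λ i → wordSum n (λ w → ι (p (g i ∷ w))))
    go zero g = refl
    go (suc M) g = trans (cong toℚ (countB-++ p (map (g 0 ∷_) (allLists n K)) _))
      (trans (toℚ-+ (countB p (map (g 0 ∷_) (allLists n K))) _)
      (cong₂ _+_ (trans (cong toℚ (count-map (g 0) (allLists n K))) (countB-wordSum n (λ w → p (g 0 ∷ w)))) (go M (g ∘ suc))))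

-- Monomials of fillings

ι-∧ : ∀ x y → ι (x ∧ y) ≡ ι x * ι y
ι-∧ true y = sym (ℚₚ.*-identityˡ (ι y))
ι-∧ false y = sym (ℚₚ.*-zeroˡ (ι y))

-- Multiplication by the variable x_j, by 1 when j = 0 or when there are fewer than j variables.
E : ℕ → Fn → Fn
E zero g a = g a
E (suc j) g [] = g []
E (suc zero) g (zero ∷ a) = 0ℚ
E (suc zero) g (suc x ∷ a) = g (x ∷ a)
E (suc (suc j)) g (x ∷ a) = E (suc j) (at x g) a

E-linear : ∀ j → Linear (E j)
E-linear zero f g k e a = e a
E-linear (suc j) f g k e [] = e []
E-linear (suc zero) f g k e (zero ∷ a) = zero-lin k
E-linear (suc zero) f g k e (suc x ∷ a) = e (x ∷ a)
E-linear (suc (suc j)) f g k e (x ∷ a) = E-linear (suc j) (at x f) (at x g) k (λ a → e (x ∷ a)) a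

E-cong : ∀ j f g a → (∀ b → length b ≡ length a → f b ≡ g b) → E j f a ≡ E j g a
E-cong zero f g a e = e a refl
E-cong (suc j) f g [] e = e [] refl
E-cong (suc zero) f g (zero ∷ a) e = refl
E-cong (suc zero) f g (suc x ∷ a) e = e (x ∷ a) refl
E-cong (suc (suc j)) f g (x ∷ a) e = E-cong (suc j) (at x f) (at x g) a (λ b l → e (x ∷ b) (cong suc l))

Ew : List ℕ → Fn → Fn
Ew [] g = g
Ew (v ∷ w) g = E (letterValue v) (Ew w g)

Ew-linear : ∀ w → Linear (Ew w)
Ew-linear [] f g k e = e
Ew-linear (v ∷ w) f g k e = E-linear (letterValue v) (Ew w f) (Ew w g) k (Ew-linear w f g k e)

Ew-cong : ∀ w f g a → (∀ b → length b ≡ length a → f b ≡ g b) → Ew w f a ≡ Ew w g a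
Ew-cong [] f g a e = e a refl
Ew-cong (v ∷ w) f g a e =
  E-cong (letterValue v) (Ew w f) (Ew w g) a (λ b l → Ew-cong w f g b (λ c l' → e c (trans l' l)))

agree : (ℕ → ℕ) → List ℕ → Bool
agree c [] = true
agree c (x ∷ a) = (c 0 ≡ᵇ x) ∧ agree (c ∘ suc) a

counts : List ℕ → ℕ → ℕ
counts f i = countB (λ v → letterValue v ≡ᵇ suc i) f

-- The monomial of the filling `f` as a coefficient function, in as many variables as `a` has
-- entries.
wt : List ℕ → Fn
wt f a = ι (agree (counts f) a)

agree-content : ∀ f a → eqListB (contentOf (length a) f) a ≡ agree (counts f) a
agree-content f a = go suc (λ j → countB (λ v → letterValue v ≡ᵇ j) f) a
  where
  go : ∀ (g : ℕ → ℕ) (c : ℕ → ℕ) a → eqListB (map c (applyUpTo g (length a))) a ≡ agree (c ∘ g) a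
  go g c [] = refl
  go g c (x ∷ a) = cong ((c (g 0) ≡ᵇ x) ∧_) (go (g ∘ suc) c a)

agree-cong : ∀ {c c'} a → (∀ i → c i ≡ c' i) → agree c a ≡ agree c' a
agree-cong [] e = refl
agree-cong (x ∷ a) e = cong₂ (λ y z → (y ≡ᵇ x) ∧ z) (e 0) (agree-cong a (e ∘ suc))

wt-∷ : ∀ v f → wt (v ∷ f) ≈ E (letterValue v) (wt f)
wt-∷ v f a = go (letterValue v) (counts f) a
  where
  bump : ℕ → (ℕ → ℕ) → ℕ → ℕ
  bump j c i = if j ≡ᵇ suc i then suc (c i) else c i
  go : ∀ j c a → ι (agree (bump j c) a) ≡ E j (λ a' → ι (agree c a')) a
  go zero c a = refl
  go (suc j) c [] = refl
  go (suc zero) c (zero ∷ a) = refl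
  go (suc zero) c (suc x ∷ a) = refl
  go (suc (suc j)) c (x ∷ a) with c 0 ≡ᵇ x
  ... | true = go (suc j) (c ∘ suc) a
  ... | false = sym (lin-𝟘 (E-linear (suc j)) a)

wt-++ : ∀ w f → wt (w ++ f) ≈ Ew w (wt f)
wt-++ [] f a = refl
wt-++ (v ∷ w) f a = trans (wt-∷ v (w ++ f) a)
  (lin-cong (E-linear (letterValue v)) (wt (w ++ f)) (Ew w (wt f)) (wt-++ w f) a)

wt-swap : ∀ u w f → wt (u ++ w ++ f) ≈ wt ((w ++ u) ++ f)
wt-swap u w f a = cong ι (agree-cong a eq)
  where
  eq : ∀ i → counts (u ++ w ++ f) i ≡ counts ((w ++ u) ++ f) i
  eq i = let p = λ v → letterValue v ≡ᵇ suc i in begin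
    countB p (u ++ w ++ f) ≡⟨ trans (countB-++ p u (w ++ f)) (cong (countB p u ℕ.+_) (countB-++ p w f)) ⟩
    countB p u ℕ.+ (countB p w ℕ.+ countB p f) ≡⟨ sym (ℕₚ.+-assoc (countB p u) _ _) ⟩
    countB p u ℕ.+ countB p w ℕ.+ countB p f ≡⟨ cong (ℕ._+ countB p f) (ℕₚ.+-comm (countB p u) _) ⟩
    countB p w ℕ.+ countB p u ℕ.+ countB p f ≡⟨ cong (ℕ._+ countB p f) (sym (countB-++ p w u)) ⟩
    countB p (w ++ u) ℕ.+ countB p f ≡⟨ sym (countB-++ p (w ++ u) f) ⟩
    countB p ((w ++ u) ++ f) ∎

wt-[] : wt [] ≈ one
wt-[] a = trans (cong ι (go a)) (lem (all (_≡ᵇ 0) a))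
  where
  go : ∀ a → agree (counts []) a ≡ all (_≡ᵇ 0) a
  go [] = refl
  go (zero ∷ a) = go a
  go (suc x ∷ a) = refl
  lem : ∀ b → ι b ≡ toℚ (if b then 1 else 0)
  lem true = refl
  lem false = refl

-- Sum over the admissible rows of length m with letters 1, …, K and first letter ≥ l.
rowSumFrom : ℕ → ℕ → ℕ → (List ℕ → ℚ) → ℚ
rowSumFrom K l zero φ = φ []
rowSumFrom K l (suc m) φ = ∑ K (λ i → ι (l ≤ᵇ suc i) * rowSumFrom K (next (suc i)) m (λ w → φ (suc i ∷ w)))

wordSum-row : ∀ K v m φ → wordSum K m (λ w → ι (rowFrom v w) * φ w) ≡ rowSumFrom K (next v) m φ
wordSum-row K v zero φ = ℚₚ.*-identityˡ (φ [])
wordSum-row K v (suc m) φ = ∑-cong K λ i → begin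
  wordSum K m (λ w → ι (okRow v (suc i) ∧ rowFrom (suc i) w) * φ (suc i ∷ w))
    ≡⟨ wordSum-cong K m (λ w _ → trans (cong (_* φ (suc i ∷ w)) (ι-∧ (okRow v (suc i)) (rowFrom (suc i) w)))
                                  (ℚₚ.*-assoc (ι (okRow v (suc i))) _ _)) ⟩
  wordSum K m (λ w → ι (okRow v (suc i)) * (ι (rowFrom (suc i) w) * φ (suc i ∷ w)))
    ≡⟨ wordSum-scale K m (λ w → ι (rowFrom (suc i) w) * φ (suc i ∷ w)) (ι (okRow v (suc i))) ⟩
  ι (okRow v (suc i)) * wordSum K m (λ w → ι (rowFrom (suc i) w) * φ (suc i ∷ w))
    ≡⟨ cong (ι (okRow v (suc i)) *_) (wordSum-row K (suc i) m (λ w → φ (suc i ∷ w))) ⟩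
  ι (okRow v (suc i)) * rowSumFrom K (next (suc i)) m (λ w → φ (suc i ∷ w)) ∎

rowSumFrom-cong : ∀ K l m {φ ψ} → (∀ w → φ w ≡ ψ w) → rowSumFrom K l m φ ≡ rowSumFrom K l m ψ
rowSumFrom-cong K l zero e = e []
rowSumFrom-cong K l (suc m) e = ∑-cong K (λ i → cong (ι (l ≤ᵇ suc i) *_) (rowSumFrom-cong K (next (suc i)) m (λ w → e (suc i ∷ w))))

drop₁ : ∀ x y → 0ℚ * x + y ≡ y
drop₁ = solve-∀ ℚring

drop₂ : ∀ x y z → 0ℚ * x + (0ℚ * y + z) ≡ z
drop₂ = solve-∀ ℚring

keep₁ : ∀ x y → 1ℚ * x + y ≡ x + y
keep₁ = solve-∀ ℚring

next-+2 : ∀ v → next (suc (suc v)) ≡ suc (suc (next v))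
next-+2 v with isMarked v
... | true = refl
... | false = refl

next-suc : ∀ i → ∃ λ l → next (suc i) ≡ suc l
next-suc i with isMarked i
... | true = i , refl
... | false = suc i , refl

-- Lowering codes by 2 lowers values by 1 and keeps the marks, so rows without 1' and 1 become rows
-- for one variable fewer.
rowSumFrom-shift : ∀ K l m φ → rowSumFrom (suc (suc K)) (suc (suc (suc l))) m φ ≡ rowSumFrom K (suc l) m (λ w → φ (map (λ v → suc (suc v)) w))
rowSumFrom-shift K l zero φ = refl
rowSumFrom-shift K l (suc m) φ =
  trans (drop₂ (rowSumFrom (suc (suc K)) 2 m (λ w → φ (1 ∷ w))) (rowSumFrom (suc (suc K)) 2 m (λ w → φ (2 ∷ w)))
               (∑ K λ i → ι (suc l ≤ᵇ suc i) * rowSumFrom (suc (suc K)) (next (suc (suc (suc i)))) m (λ w → φ (suc (suc (suc i)) ∷ w))))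
  (∑-cong K λ i → cong (ι (suc l ≤ᵇ suc i) *_)
    (trans (cong (λ z → rowSumFrom (suc (suc K)) z m (λ w → φ (suc (suc (suc i)) ∷ w))) (next-+2 (suc i))) (step i)))
  where
  step : ∀ i → rowSumFrom (suc (suc K)) (suc (suc (next (suc i)))) m (λ w → φ (suc (suc (suc i)) ∷ w)) ≡
               rowSumFrom K (next (suc i)) m (λ w → φ (suc (suc (suc i)) ∷ map (λ v → suc (suc v)) w))
  step i with next (suc i) | next-suc i
  ... | .(suc l') | l' , refl = rowSumFrom-shift K l' m (λ w → φ (suc (suc (suc i)) ∷ w))

letterValue-pos : ∀ i → ∃ λ j → letterValue (suc i) ≡ suc j
letterValue-pos zero = 0 , refl
letterValue-pos (suc i) = letterValue i , refl

rowSumFrom-positive : ∀ K l m {φ ψ} → (∀ w → All (1 ≤_) w → φ w ≡ ψ w) → rowSumFrom K l m φ ≡ rowSumFrom K l m ψ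
rowSumFrom-positive K l zero e = e [] []
rowSumFrom-positive K l (suc m) e = ∑-cong K (λ i → cong (ι (l ≤ᵇ suc i) *_)
  (rowSumFrom-positive K (next (suc i)) m (λ w p → e (suc i ∷ w) (s≤s z≤n ∷ p))))

-- Raised letters leave the first variable alone. Positivity excludes code 0, which acts as the
-- identity but would be raised to the letter 1.
Ew-shift : ∀ w g x a → All (1 ≤_) w → Ew (map (λ v → suc (suc v)) w) g (x ∷ a) ≡ Ew w (at x g) a
Ew-shift [] g x a [] = refl
Ew-shift (suc i ∷ w) g x a (_ ∷ p) with letterValue (suc i) | letterValue-pos i
... | .(suc j) | j , refl = lin-cong (E-linear (suc j)) (at x (Ew (map (λ v → suc (suc v)) w) g)) (Ew w (at x g))
                              (λ a → Ew-shift w g x a p) a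

twice : ℕ → ℕ
twice zero = 0
twice (suc n) = suc (suc (twice n))

-- Induction on the number of variables. A row starts with 1', with 1, or with a larger letter;
-- after 1' and after 1 the same continuations are allowed (`H`), and rows of larger letters fall
-- under the induction hypothesis (`bigger`).
rowSum : ∀ m g a → rowSumFrom (twice (length a)) 1 m (λ w → Ew w g a) ≡ Q m g a
rowSum zero g a = refl
rowSum (suc m) g [] = refl
rowSum (suc m) g (x ∷ a) = from₁ x
  where
  K = twice (length a)
  H : ℕ → ℕ → ℚ
  H m x = rowSumFrom (suc (suc K)) 2 m (λ w → Ew w g (x ∷ a))
  bigger : ∀ m x → rowSumFrom (suc (suc K)) 3 m (λ w → Ew w g (x ∷ a)) ≡ Q m (at x g) a
  bigger m x = trans (rowSumFrom-shift K 0 m (λ w → Ew w g (x ∷ a)))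
    (trans (rowSumFrom-positive K 1 m (λ w p → Ew-shift w g x a p)) (rowSum m (at x g) a))
  F : ℕ → ℕ → ℚ
  F m zero = 0ℚ
  F m (suc x) = H m x
  first : ∀ m x v → letterValue v ≡ 1 → rowSumFrom (suc (suc K)) 2 m (λ w → Ew (v ∷ w) g (x ∷ a)) ≡ F m x
  first m zero v e = trans (rowSumFrom-cong (suc (suc K)) 2 m (λ w → cong (λ j → E j (Ew w g) (zero ∷ a)) e)) (vanish (suc (suc K)) 2 m)
    where
    vanish : ∀ K l m → rowSumFrom K l m (λ _ → 0ℚ) ≡ 0ℚ
    vanish K l zero = refl
    vanish K l (suc m) = trans (∑-cong K (λ i →
      trans (cong (ι (l ≤ᵇ suc i) *_) (vanish K (next (suc i)) m)) (ℚₚ.*-zeroʳ (ι (l ≤ᵇ suc i)))))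
                               (∑-0 K)
  first m (suc x) v e = rowSumFrom-cong (suc (suc K)) 2 m (λ w → cong (λ j → E j (Ew w g) (suc x ∷ a)) e)
  A : ℕ → ℕ → ℕ → ℚ
  A m x v = rowSumFrom (suc (suc K)) 2 m (λ w → Ew (v ∷ w) g (x ∷ a))
  tail : ℕ → ℕ → ℚ
  tail m x = ∑ K (λ i → 1ℚ * rowSumFrom (suc (suc K)) (next (suc (suc (suc i)))) m (λ w → Ew (suc (suc (suc i)) ∷ w) g (x ∷ a)))
  rest : ∀ m x → tail m x ≡ Q (suc m) (at x g) a
  rest m x = trans (sym (drop₂ (A m x 1) (A m x 2) (tail m x))) (bigger (suc m) x)
  from₂ : ∀ m x → H (suc m) x ≡ F m x + Q (suc m) (at x g) a
  from₂ m x = trans (drop₁ (A m x 1) (1ℚ * A m x 2 + tail m x))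
    (trans (keep₁ (A m x 2) (tail m x)) (cong₂ _+_ (first m x 2 refl) (rest m x)))
  -- `H` has the first-variable factor 1/(1 - z), and 2/(1 - z) = (1 + z)/(1 - z) + 1; the two equal
  -- contributions of 1' and 1 are thus rewritten in terms of `Q`.
  double : ∀ m x → H m x + H m x ≡ Q m g (x ∷ a) + Q m (at x g) a
  double zero x = refl
  double (suc m) zero = cong₂ _+_ z z
    where
    z : H (suc m) 0 ≡ Q (suc m) (at 0 g) a
    z = trans (from₂ m 0) (ℚₚ.+-identityˡ (Q (suc m) (at 0 g) a))
  double (suc m) (suc x) = trans (cong₂ _+_ (from₂ m (suc x)) (from₂ m (suc x)))
    (trans (p (H m x) q) (trans (cong (_+ (q + q)) (double m x)) (p' (Q m g (x ∷ a)) (Q m (at x g) a) q)))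
    where
    q = Q (suc m) (at (suc x) g) a
    p : ∀ h q → h + q + (h + q) ≡ (h + h) + (q + q)
    p = solve-∀ ℚring
    p' : ∀ x y z → x + y + (z + z) ≡ x + z + y + z
    p' = solve-∀ ℚring
  split : ∀ m x → rowSumFrom (suc (suc K)) 1 (suc m) (λ w → Ew w g (x ∷ a)) ≡ F m x + (F m x + Q (suc m) (at x g) a)
  split m x = trans (keep₁ (A m x 1) (1ℚ * A m x 2 + tail m x)) (cong₂ _+_ (first m x 1 refl)
    (trans (keep₁ (A m x 2) (tail m x)) (cong₂ _+_ (first m x 2 refl) (rest m x))))
  from₁ : ∀ x → rowSumFrom (suc (suc K)) 1 (suc m) (λ w → Ew w g (x ∷ a)) ≡ Q (suc m) g (x ∷ a)
  from₁ zero = trans (split m 0) (p (Q (suc m) (at 0 g) a))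
    where
    p : ∀ x → 0ℚ + (0ℚ + x) ≡ x
    p = solve-∀ ℚring
  from₁ (suc x) = trans (split m (suc x)) (trans (sym (ℚₚ.+-assoc (H m x) (H m x) (Q (suc m) (at (suc x) g) a)))
    (trans (cong (_+ Q (suc m) (at (suc x) g) a) (double m x))
           (p (Q m g (x ∷ a)) (Q m (at x g) a) (Q (suc m) (at (suc x) g) a))))
    where
    p : ∀ x y z → x + y + z ≡ x + z + y
    p = solve-∀ ℚring

-- Gluing successive rows

rowFrom-++ : ∀ v w u w' → rowFrom v (w ++ u ∷ w') ≡ (okRow (lastOf v w) u ∧ rowFrom u w') ∧ rowFrom v w
rowFrom-++ v [] u w' = sym (∧-identityʳ _)
rowFrom-++ v (x ∷ w) u w' = trans (cong (okRow v x ∧_) (rowFrom-++ x w u w'))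
  (exchange (okRow v x) (okRow (lastOf x w) u ∧ rowFrom u w') (rowFrom x w))
  where
  exchange : ∀ a b c → a ∧ (b ∧ c) ≡ b ∧ (a ∧ c)
  exchange true b c = refl
  exchange false true c = refl
  exchange false false c = refl

valid-merge : ∀ x w u w' ws → valid ((x ∷ w ++ u ∷ w') ∷ ws) ≡ (okRow (lastOf x w) u ∧ rowFrom u w') ∧ valid ((x ∷ w) ∷ ws)
valid-merge x w u w' [] = rowFrom-++ x w u w'
valid-merge x w u w' (w'' ∷ ws) = trans (cong (_∧ V) (rowFrom-++ x w u w'))
  (∧-assoc (okRow (lastOf x w) u ∧ rowFrom u w') (rowFrom x w) V)
  where
  V = okCol x (lastOf 0 w'') ∧ valid (w'' ∷ ws)

-- Two successive rows u (above) and w either satisfy the column condition or can be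
-- glued into the single row w u.
valid-split : ∀ u w ws → NonEmpty u → NonEmpty w →
  ι (valid (u ∷ w ∷ ws)) ≡ ι (rowFrom 0 u) * ι (valid (w ∷ ws)) + (- 1ℚ) * ι (valid ((w ++ u) ∷ ws))
valid-split (y ∷ u) (x ∷ w) ws _ _ =
  trans (go (rowFrom y u) (okRow (lastOf x w) y) (valid ((x ∷ w) ∷ ws)))
        (cong (λ z → ι (rowFrom y u) * ι (valid ((x ∷ w) ∷ ws)) + (- 1ℚ) * ι z) (sym (valid-merge x w y u ws)))
  where
  go : ∀ r o V → ι (r ∧ (not o ∧ V)) ≡ ι r * ι V + (- 1ℚ) * ι ((o ∧ r) ∧ V)
  go true true true = refl
  go true true false = refl
  go true false true = refl
  go true false false = refl
  go false true true = refl
  go false true false = refl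
  go false false true = refl
  go false false false = refl

ribbonSum : ℕ → List ℕ → Fn
ribbonSum K α A = tupleSum K α (λ ws → ι (valid ws) * wt (concat ws) A)

ribbonSum-single : ∀ K a A → ribbonSum K (a ∷ []) A ≡ wordSum K a (λ w → ι (rowFrom 0 w) * Ew w one A)
ribbonSum-single K a A = wordSum-cong K a (λ w _ → cong (ι (rowFrom 0 w) *_)
  (trans (wt-++ w [] A) (lin-cong (Ew-linear w) (wt []) one wt-[] A)))

ribbonSum-merge : ∀ K a b β A → 1 ≤ a → 1 ≤ b → ribbonSum K (a ∷ b ∷ β) A ≡
  wordSum K a (λ u → ι (rowFrom 0 u) * Ew u (ribbonSum K (b ∷ β)) A) + (- 1ℚ) * ribbonSum K (b ℕ.+ a ∷ β) A
ribbonSum-merge K a b β A la lb = begin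
  wordSum K a (λ u → tupleSum K (b ∷ β) (λ ws → ι (valid (u ∷ ws)) * wt (u ++ concat ws) A))
    ≡⟨ wordSum-cong K a (λ u lu → trans (wordSum-cong K b (λ w lw → trans (tupleSum-cong K β (λ ws _ → point u w ws lu lw))
         (tupleSum-lin K β (λ ws → ι (rowFrom 0 u) * Φ u (w ∷ ws)) (Ψ u w) (- 1ℚ))))
         (wordSum-lin K b (λ w → tupleSum K β (λ ws → ι (rowFrom 0 u) * Φ u (w ∷ ws))) (λ w → tupleSum K β (Ψ u w)) (- 1ℚ))) ⟩
  wordSum K a (λ u → tupleSum K (b ∷ β) (λ ws → ι (rowFrom 0 u) * Φ u ws) + (- 1ℚ) * wordSum K b (λ w → tupleSum K β (Ψ u w)))
    ≡⟨ wordSum-lin K a (λ u → tupleSum K (b ∷ β) (λ ws → ι (rowFrom 0 u) * Φ u ws)) (λ u → wordSum K b (λ w → tupleSum K β (Ψ u w))) (- 1ℚ) ⟩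
  wordSum K a (λ u → tupleSum K (b ∷ β) (λ ws → ι (rowFrom 0 u) * Φ u ws)) + (- 1ℚ) * wordSum K a (λ u → wordSum K b (λ w → tupleSum K β (Ψ u w)))
    ≡⟨ cong₂ (λ x y → x + (- 1ℚ) * y)
         (wordSum-cong K a (λ u _ → trans (tupleSum-scale K (b ∷ β) (Φ u) (ι (rowFrom 0 u))) (cong (ι (rowFrom 0 u) *_) (factor u))))
         -- The glued row reads the lower word first, so the two sums are exchanged before they
         -- combine into one over words of length `b + a`.
         (trans (wordSum-swap K a b (λ u w → tupleSum K β (Ψ u w)))
                (sym (wordSum-++ K b a (λ v → tupleSum K β (λ ws → ι (valid (v ∷ ws)) * wt (v ++ concat ws) A))))) ⟩
  wordSum K a (λ u → ι (rowFrom 0 u) * Ew u (ribbonSum K (b ∷ β)) A) + (- 1ℚ) * ribbonSum K (b ℕ.+ a ∷ β) A ∎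
  where
  Φ : List ℕ → List (List ℕ) → ℚ
  Φ u ws = ι (valid ws) * wt (u ++ concat ws) A
  Ψ : List ℕ → List ℕ → List (List ℕ) → ℚ
  Ψ u w ws = ι (valid ((w ++ u) ∷ ws)) * wt ((w ++ u) ++ concat ws) A
  point : ∀ u w ws → length u ≡ a → length w ≡ b →
          ι (valid (u ∷ w ∷ ws)) * wt (u ++ w ++ concat ws) A ≡ ι (rowFrom 0 u) * Φ u (w ∷ ws) + (- 1ℚ) * Ψ u w ws
  point u w ws lu lw =
    trans (cong (_* t) (valid-split u w ws (subst (1 ≤_) (sym lu) la) (subst (1 ≤_) (sym lw) lb)))
    (trans (p (ι (rowFrom 0 u)) (ι (valid (w ∷ ws))) (ι (valid ((w ++ u) ∷ ws))) t)
           (cong (λ z → ι (rowFrom 0 u) * Φ u (w ∷ ws) + (- 1ℚ) * (ι (valid ((w ++ u) ∷ ws)) * z)) (wt-swap u w (concat ws) A)))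
    where
    t = wt (u ++ w ++ concat ws) A
    p : ∀ r v m t → (r * v + (- 1ℚ) * m) * t ≡ r * (v * t) + (- 1ℚ) * (m * t)
    p = solve-∀ ℚring
  factor : ∀ u → tupleSum K (b ∷ β) (Φ u) ≡ Ew u (ribbonSum K (b ∷ β)) A
  factor u = trans (tupleSum-cong K (b ∷ β) (λ ws _ → trans (cong (ι (valid ws) *_) (wt-++ u (concat ws) A))
                      (sym (lin-⊙ (Ew-linear u) (ι (valid ws)) (wt (concat ws)) A))))
                   (tupleSum-op K (Ew-linear u) (b ∷ β) (λ ws A' → ι (valid ws) * wt (concat ws) A') A)

-- The alphabet is tied to the number N of variables, so a ribbon sum can agree with its `R` only on
-- contents of length N; multiplication by a variable preserves that length.
rows-Q : ∀ N a f g → (∀ A → length A ≡ N → f A ≡ g A) → ∀ A → length A ≡ N →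
         wordSum (twice N) a (λ w → ι (rowFrom 0 w) * Ew w f A) ≡ Q a g A
rows-Q N a f g e A refl =
  trans (wordSum-cong (twice N) a (λ w _ → cong (ι (rowFrom 0 w) *_) (Ew-cong w f g A e)))
  (trans (wordSum-row (twice N) 0 a (λ w → Ew w g A)) (trans (from₁ a) (rowSum a g A)))
  where
  -- Letters start at code 1, so the lower bounds 0 and 1 admit the same rows.
  from₁ : ∀ a → rowSumFrom (twice N) 0 a (λ w → Ew w g A) ≡ rowSumFrom (twice N) 1 a (λ w → Ew w g A)
  from₁ zero = refl
  from₁ (suc a) = refl

ribbonSum≡R : ∀ N a β → 1 ≤ a → All (1 ≤_) β → ∀ A → length A ≡ N → ribbonSum (twice N) (a ∷ β) A ≡ R a β A
ribbonSum≡R N a [] la lβ A lA = trans (ribbonSum-single (twice N) a A) (rows-Q N a one one (λ _ _ → refl) A lA)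
ribbonSum≡R N a (b ∷ β) la (lb ∷ lβ) A lA =
  trans (ribbonSum-merge (twice N) a b β A la lb)
        (cong₂ (λ x y → x + (- 1ℚ) * y)
          (rows-Q N a (ribbonSum (twice N) (b ∷ β)) (R b β) (ribbonSum≡R N b β lb lβ) A lA)
          (ribbonSum≡R N (b ℕ.+ a) β (ℕₚ.≤-trans lb (ℕₚ.m≤m+n b a)) lβ A lA))

length-ribbonRows : ∀ r α → length (ribbonRows r α) ≡ sum α
length-ribbonRows r [] = refl
length-ribbonRows r (a ∷ α) = trans (length-++ (map _ (upTo a)))
  (cong₂ ℕ._+_ (trans (length-map _ (upTo a)) (length-upTo a)) (length-ribbonRows (suc r) α))

2*≡twice : ∀ n → 2 ℕ.* n ≡ twice n
2*≡twice zero = refl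
2*≡twice (suc n) = cong suc (trans (ℕₚ.+-suc n (n ℕ.+ 0)) (cong suc (2*≡twice n)))

rCoeff≡R : ∀ a β → 1 ≤ a → All (1 ≤_) β → ∀ A → toℚ (rCoeff (ribbon (a ∷ β)) A) ≡ R a β A
rCoeff≡R a β la lβ A = begin
  toℚ (countB p (allLists (length (ribbon α)) (2 ℕ.* length A)))
    ≡⟨ cong₂ (λ x y → toℚ (countB p (allLists x y))) (length-ribbonRows 1 α) (2*≡twice (length A)) ⟩
  toℚ (countB p (allLists (sum α) K)) ≡⟨ countB-wordSum K (sum α) p ⟩
  wordSum K (sum α) (ι ∘ p) ≡⟨ wordSum-concat K α (ι ∘ p) ⟩
  tupleSum K α (ι ∘ p ∘ concat) ≡⟨ tupleSum-cong K α point ⟩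
  ribbonSum K α A ≡⟨ ribbonSum≡R (length A) a β la lβ A refl ⟩
  R a β A ∎
  where
  α = a ∷ β
  K = twice (length A)
  p : List ℕ → Bool
  p f = isTableau (ribbon α) f ∧ eqListB (contentOf (length A) f) A
  nonEmpty : ∀ ws {γ} → All (1 ≤_) γ → map length ws ≡ γ → All NonEmpty ws
  nonEmpty [] l refl = []
  nonEmpty (w ∷ ws) (l ∷ ls) refl = l ∷ nonEmpty ws ls refl
  point : ∀ ws → map length ws ≡ α → ι (p (concat ws)) ≡ ι (valid ws) * wt (concat ws) A
  point ws e = trans (ι-∧ (isTableau (ribbon α) (concat ws)) _) (cong₂ (λ x y → ι x * ι y)
    (trans (cong (λ z → allPairsOK (zip (ribbonRows 1 z) (concat ws))) (sym e))
           (trans (cong allPairsOK (zip-ribbon 1 ws)) (isTableau-valid 1 ws (nonEmpty ws (la ∷ lβ) e))))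
    (agree-content (concat ws) A))

-- Compositions and the choice of b

ε-odd : ∀ n → Odd n → ε n ≡ 2ℚ
ε-odd (suc zero) o = refl
ε-odd (suc (suc n)) o = ε-odd n o

odd-pos : ∀ n → Odd n → 1 ≤ n
odd-pos (suc n) o = s≤s z≤n

sgn-odd : ∀ β → Odd (suc (length β)) → sgn β ≡ 1ℚ
sgn-odd [] o = refl
sgn-odd (x ∷ y ∷ β) o = cong (λ s → - (- s)) (sgn-odd β o)

odd-complement : ∀ b c → Odd b → Odd (suc (b ℕ.+ c)) → Odd c
odd-complement (suc zero) c p q = q
odd-complement (suc (suc b)) c p q = odd-complement b c p q

-- The five booleans are the memberships of b, c, b + c, 1 + b and 1 + c in the set of partial
-- sums, for a composition of 1 + b + c starting with 1.
Obstructed : Bool → Bool → Bool → Bool → Bool → Set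
Obstructed b c bc 1b 1c =
  (b ≡ true × 1b ≡ false × bc ≡ false) ⊎
  (bc ≡ true × (b ≡ false ⊎ 1b ≡ false) × (c ≡ false ⊎ 1c ≡ false))

mem-first : ∀ β → 1 ≤ sum β → mem 1 1 β ≡ true
mem-first (x ∷ β) l = refl

-- With 1 ∈ S the count reduces to -[b](1 - [1+b] - [b+c]) - [c](1 - [1+c] - [b+c]) - [b+c]. For b+c
-- outside S no term is positive and the one of b is -1; for b+c in S it equals [b][1+b] + [c][1+c]
-- - 1, where both products vanish.
Z-negative : ∀ b c bc 1b 1c → Obstructed b c bc 1b 1c →
             ¬ (0ℚ ≤ℚ 8ℚ * 1ℚ * Z 1ℚ (ι b) (ι c) (ι 1b) (ι 1c) (ι bc))
Z-negative true true false false true (inj₁ _) = toWitnessFalse {a? = _ ℚₚ.≤? _} _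
Z-negative true true false false false (inj₁ _) = toWitnessFalse {a? = _ ℚₚ.≤? _} _
Z-negative true false false false true (inj₁ _) = toWitnessFalse {a? = _ ℚₚ.≤? _} _
Z-negative true false false false false (inj₁ _) = toWitnessFalse {a? = _ ℚₚ.≤? _} _
Z-negative true true true false false (inj₂ _) = toWitnessFalse {a? = _ ℚₚ.≤? _} _
Z-negative true false true false true (inj₂ _) = toWitnessFalse {a? = _ ℚₚ.≤? _} _
Z-negative true false true false false (inj₂ _) = toWitnessFalse {a? = _ ℚₚ.≤? _} _
Z-negative false true true true false (inj₂ _) = toWitnessFalse {a? = _ ℚₚ.≤? _} _
Z-negative false true true false false (inj₂ _) = toWitnessFalse {a? = _ ℚₚ.≤? _} _
Z-negative false false true true true (inj₂ _) = toWitnessFalse {a? = _ ℚₚ.≤? _} _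
Z-negative false false true true false (inj₂ _) = toWitnessFalse {a? = _ ℚₚ.≤? _} _
Z-negative false false true false true (inj₂ _) = toWitnessFalse {a? = _ ℚₚ.≤? _} _
Z-negative false false true false false (inj₂ _) = toWitnessFalse {a? = _ ℚₚ.≤? _} _
Z-negative _ _ false _ _ (inj₂ (() , _))
Z-negative true _ true true _ (inj₂ (_ , inj₁ () , _))
Z-negative true _ true true _ (inj₂ (_ , inj₂ () , _))
Z-negative _ true true _ true (inj₂ (_ , _ , inj₁ ()))
Z-negative _ true true _ true (inj₂ (_ , _ , inj₂ ()))

-- The coefficient of p₁ p_b p_c in 𝔯_D is negative.
obstruction : ∀ b c β → All (1 ≤_) β → Odd (suc (length β)) → Odd b → Odd c → sum β ≡ b ℕ.+ c →
              Obstructed (mem b 1 β) (mem c 1 β) (mem (sum β) 1 β) (mem (1 ℕ.+ b) 1 β) (mem (1 ℕ.+ c) 1 β) →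
              ¬ PPositive (ribbon (1 ∷ β))
obstruction b c β pos ol ob oc e obs pp =
  Z-negative (mem b 1 β) (mem c 1 β) (mem (b ℕ.+ c) 1 β) (mem (1 ℕ.+ b) 1 β) (mem (1 ℕ.+ c) 1 β)
    (subst (λ n → Obstructed (mem b 1 β) (mem c 1 β) (mem n 1 β) (mem (1 ℕ.+ b) 1 β) (mem (1 ℕ.+ c) 1 β)) e obs)
    (subst (0ℚ ≤ℚ_) value (pPositive-nonneg (ribbon (1 ∷ β)) pp (1 ∷ b ∷ c ∷ [])))
  where
  value : Wl (1 ∷ b ∷ c ∷ []) (toℚ ∘ rCoeff (ribbon (1 ∷ β))) [] ≡
          8ℚ * 1ℚ * Z 1ℚ (μ b 1 β) (μ c 1 β) (μ (1 ℕ.+ b) 1 β) (μ (1 ℕ.+ c) 1 β) (μ (b ℕ.+ c) 1 β)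
  value = trans (lin-cong (Wl-linear (1 ∷ b ∷ c ∷ [])) (toℚ ∘ rCoeff (ribbon (1 ∷ β))) (R 1 β)
                  (rCoeff≡R 1 β (s≤s z≤n) pos) [])
          (trans (W-R³ refl (ε-odd b ob) (ε-odd c oc) (s≤s z≤n) (odd-pos b ob) (odd-pos c oc) 1 β (s≤s z≤n) pos (cong suc e))
                 (cong₂ (λ s t → 8ℚ * s * Z (ι t) (μ b 1 β) (μ c 1 β) (μ (1 ℕ.+ b) 1 β) (μ (1 ℕ.+ c) 1 β) (μ (b ℕ.+ c) 1 β))
                   (sgn-odd β ol) (mem-first β (subst (1 ≤_) (sym e) (ℕₚ.≤-trans (odd-pos b ob) (ℕₚ.m≤m+n b c))))))

-- Partial sums near the two ends of the composition

mem-∷ʳ : ∀ x a γ l → mem x a (γ ∷ʳ l) ≡ mem x a γ ∨ (a ℕ.+ sum γ ≡ᵇ x)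
mem-∷ʳ x a [] l = trans (∨-identityʳ (a ≡ᵇ x)) (cong (_≡ᵇ x) (sym (ℕₚ.+-identityʳ a)))
mem-∷ʳ x a (b ∷ γ) l = trans (cong ((a ≡ᵇ x) ∨_) (trans (mem-∷ʳ x (b ℕ.+ a) γ l)
    (cong (λ n → mem x (b ℕ.+ a) γ ∨ (n ≡ᵇ x)) (sum-merge a b γ))))
  (sym (∨-assoc (a ≡ᵇ x) (mem x (b ℕ.+ a) γ) _))

mem-above : ∀ x a β → All (1 ≤_) β → a ℕ.+ sum β ≤ x → mem x a β ≡ false
mem-above x a [] p l = refl
mem-above x a (b ∷ β) (lb ∷ p) l = cong₂ _∨_
  (≡ᵇ-false (ℕₚ.<⇒≢ (ℕₚ.<-≤-trans (ℕₚ.m<m+n a (ℕₚ.≤-trans lb (ℕₚ.m≤m+n b (sum β)))) l)))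
  (mem-above x (b ℕ.+ a) β p (subst (_≤ x) (sym (sum-merge a b β)) l))

lastOf-∷ʳ : ∀ a γ l → lastOf a (γ ∷ʳ l) ≡ l
lastOf-∷ʳ a [] l = refl
lastOf-∷ʳ a (b ∷ γ) l = lastOf-∷ʳ b γ l

sum-∷ʳ : ∀ γ l → sum (γ ∷ʳ l) ≡ sum γ ℕ.+ l
sum-∷ʳ γ l = trans (sum-++ γ (l ∷ [])) (cong (sum γ ℕ.+_) (ℕₚ.+-identityʳ l))

leadingOnes : List ℕ → ℕ
leadingOnes [] = 0
leadingOnes (x ∷ xs) = if 2 ≤ᵇ x then 0 else suc (leadingOnes xs)

headLength-leadingOnes : ∀ β → headLength β ≡ suc (leadingOnes β)
headLength-leadingOnes [] = refl
headLength-leadingOnes (x ∷ xs) with 2 ≤ᵇ x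
... | true = refl
... | false = cong suc (headLength-leadingOnes xs)

-- A part of size at least 2 follows the leading ones, so the sum reached after them is a proper
-- partial sum and not the total.
mem-head : ∀ a β → All (1 ≤_) β → Any (2 ≤_) β → mem (leadingOnes β ℕ.+ a) a β ≡ true
mem-head a (suc zero ∷ xs) (_ ∷ p) (there q) =
  trans (cong (λ n → (a ≡ᵇ n) ∨ mem n (suc a) xs) (sym (ℕₚ.+-suc (leadingOnes xs) a)))
        (trans (cong ((a ≡ᵇ leadingOnes xs ℕ.+ suc a) ∨_) (mem-head (suc a) xs p q)) (∨-zeroʳ (a ≡ᵇ leadingOnes xs ℕ.+ suc a)))
mem-head a (suc zero ∷ xs) p (here (s≤s ()))
mem-head a (suc (suc x) ∷ xs) _ _ = cong (_∨ mem a (suc (suc x) ℕ.+ a) xs) (≡ᵇ-true {a} refl)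

-- The next part, if there is one, is at least 2 and jumps over this value; otherwise the value
-- exceeds the total.
mem-after-head : ∀ a β → All (1 ≤_) β → mem (suc (leadingOnes β) ℕ.+ a) a β ≡ false
mem-after-head a [] p = refl
mem-after-head a (suc zero ∷ xs) (_ ∷ p) = cong₂ _∨_
  (≡ᵇ-false (ℕₚ.<⇒≢ (s≤s (ℕₚ.≤-trans (ℕₚ.m≤n+m a (leadingOnes xs)) (ℕₚ.n≤1+n _)))))
  (trans (cong (λ n → mem (suc n) (suc a) xs) (sym (ℕₚ.+-suc (leadingOnes xs) a))) (mem-after-head (suc a) xs p))
mem-after-head a (suc (suc x) ∷ xs) (_ ∷ p) = cong₂ _∨_
  (≡ᵇ-false (ℕₚ.<⇒≢ (ℕₚ.n<1+n a)))
  (mem-below (suc a) (suc (suc x) ℕ.+ a) xs (s≤s (s≤s (ℕₚ.m≤n+m a x))))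

leadingOnes-sum : ∀ β → Any (2 ≤_) β → All (1 ≤_) β → 2 ℕ.+ leadingOnes β ≤ sum β
leadingOnes-sum (suc zero ∷ xs) (there q) (_ ∷ p) = s≤s (leadingOnes-sum xs q p)
leadingOnes-sum (suc zero ∷ xs) (here (s≤s ()))
leadingOnes-sum (suc (suc x) ∷ xs) _ _ = s≤s (s≤s z≤n)

-- Reversing the composition reflects its set of partial sums.
mem-tail : ∀ x a β → All (1 ≤_) β → x ℕ.+ headLength (reverse (a ∷ β)) ≡ a ℕ.+ sum β → mem x a β ≡ false
mem-tail x a β = go (reverseView β) x
  where
  go : ∀ {β} → Reverse β → ∀ x → All (1 ≤_) β → x ℕ.+ headLength (reverse (a ∷ β)) ≡ a ℕ.+ sum β → mem x a β ≡ false
  go [] x p e = refl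
  go (γ ∶ r ∶ʳ l) x p e with ∷ʳ⁻ p | trans (cong (λ z → x ℕ.+ headLength z) (sym (reverse-++ (a ∷ γ) (l ∷ []))))
      (trans e (trans (cong (a ℕ.+_) (sum-∷ʳ γ l)) (sym (ℕₚ.+-assoc a (sum γ) l))))
  go (γ ∶ r ∶ʳ suc zero) x p e | pγ , _ | e′ =
    trans (mem-∷ʳ x a γ 1) (cong₂ _∨_ (go r x pγ e″) (≡ᵇ-false λ q →
      ℕₚ.<⇒≢ (subst (x <_) e″ (ℕₚ.m<m+n x (subst (1 ≤_) (sym (headLength-leadingOnes (reverse (a ∷ γ)))) (s≤s z≤n)))) (sym q)))
    where
    e″ : x ℕ.+ headLength (reverse (a ∷ γ)) ≡ a ℕ.+ sum γ
    e″ = ℕₚ.suc-injective (trans (sym (ℕₚ.+-suc x _)) (trans e′ (ℕₚ.+-comm _ 1)))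
  -- Here the reversed head length is 1, so x is the total minus 1, above the largest proper partial
  -- sum.
  go (γ ∶ r ∶ʳ suc (suc l)) x p e | pγ , _ | e′ =
    trans (mem-∷ʳ x a γ (suc (suc l))) (cong₂ _∨_ (mem-above x a γ pγ (ℕₚ.<⇒≤ lt)) (≡ᵇ-false (ℕₚ.<⇒≢ lt)))
    where
    lt : a ℕ.+ sum γ < x
    lt = ℕₚ.≤-pred (subst (suc (suc (a ℕ.+ sum γ)) ≤_) (trans (sym e′) (ℕₚ.+-comm x 1))
           (subst (_≤ a ℕ.+ sum γ ℕ.+ suc (suc l)) (ℕₚ.+-comm _ 2) (ℕₚ.+-monoʳ-≤ (a ℕ.+ sum γ) (s≤s (s≤s z≤n)))))

allOnes⊎big : ∀ β → All (1 ≤_) β → β ≡ replicate (length β) 1 ⊎ Any (2 ≤_) β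
allOnes⊎big [] [] = inj₁ refl
allOnes⊎big (suc (suc x) ∷ β) (_ ∷ p) = inj₂ (here (s≤s (s≤s z≤n)))
allOnes⊎big (suc zero ∷ β) (_ ∷ p) with allOnes⊎big β p
... | inj₁ e = inj₁ (cong (1 ∷_) e)
... | inj₂ q = inj₂ (there q)

-- A single column is the reflected one-row block. In case (c) this excludes compositions of ones,
-- which have no part at which the initial run could end.
column-basic : ∀ n → IsBasicBlock (replicate (suc n) 1)
column-basic n = transposeD (triangle s 1) , member s , λ b → subst (λ D → (b ∈ ribbon α) ⇔ (b ∈ D)) same (mk⇔ id id)
  where
  α = replicate (suc n) 1
  s = sum α
  member : ∀ s → transposeD (triangle s 1) ∈ basicBlocks s
  member zero = there (here refl)
  member (suc zero) = there (here refl)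
  member (suc (suc zero)) = there (here refl)
  member (suc (suc (suc s))) = there (here refl)
  sum-ones : ∀ n → sum (replicate n 1) ≡ n
  sum-ones zero = refl
  sum-ones (suc n) = cong suc (sum-ones n)
  flat : ∀ n → sum (map (_∸ 1) (replicate n 1)) ≡ 0
  flat zero = refl
  flat (suc n) = flat n
  column : ∀ n r g → (∀ i → suc (g i) ≡ r ℕ.+ i) →
           ribbonRows r (replicate n 1) ≡ map swap (map (λ c → (1 , suc c)) (applyUpTo g n))
  column zero r g e = refl
  column (suc n) r g e = cong₂ _∷_
    (cong₂ _,_ (trans (sym (ℕₚ.+-identityʳ r)) (sym (e 0))) (trans (cong suc (ℕₚ.+-identityʳ _)) (cong suc (flat n))))
    (column n (suc r) (g ∘ suc) (λ i → trans (e (suc i)) (ℕₚ.+-suc r i)))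
  same : ribbon α ≡ transposeD (triangle s 1)
  same = trans (column (suc n) 1 id (λ _ → refl))
    (cong (map swap) (trans (cong (λ k → map (λ c → (1 , suc c)) (upTo k)) (sym (sum-ones (suc n)))) (sym (++-identityʳ _))))

parity : ∀ n → Even n ⊎ Odd n
parity zero = inj₁ refl
parity (suc zero) = inj₂ refl
parity (suc (suc n)) = parity n

odd-pred : ∀ n → Even (suc n) → Odd n
odd-pred (suc zero) e = refl
odd-pred (suc (suc n)) e = odd-pred n e

odd-cancel-even : ∀ m n → Even m → Odd (m ℕ.+ n) → Odd n
odd-cancel-even zero n e o = o
odd-cancel-even (suc (suc m)) n e o = odd-cancel-even m n e o

-- The three cases

module _ (γ : List ℕ) (l : ℕ) where

  private
    β = γ ∷ʳ l

  module _ (pos : All (1 ≤_) β) where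

    mem-sum-big : l > 1 → mem (sum β) 1 β ≡ false
    mem-sum-big l>1 = trans (mem-∷ʳ (sum β) 1 γ l)
      (cong₂ _∨_ (mem-above (sum β) 1 γ (proj₁ (∷ʳ⁻ pos)) (ℕₚ.<⇒≤ lt)) (≡ᵇ-false (ℕₚ.<⇒≢ lt)))
      where
      lt : suc (sum γ) < sum β
      lt = subst (suc (sum γ) <_) (sym (sum-∷ʳ γ l))
             (subst (_≤ sum γ ℕ.+ l) (ℕₚ.+-comm (sum γ) 2) (ℕₚ.+-monoʳ-≤ (sum γ) l>1))

    mem-last : mem (suc (sum γ)) 1 β ≡ true
    mem-last = trans (mem-∷ʳ (suc (sum γ)) 1 γ l)
      (trans (cong (mem (suc (sum γ)) 1 γ ∨_) (≡ᵇ-true {suc (sum γ)} refl)) (∨-zeroʳ _))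

    mem-after-last : mem (suc (suc (sum γ))) 1 β ≡ false
    mem-after-last = trans (mem-∷ʳ (suc (suc (sum γ))) 1 γ l)
      (cong₂ _∨_ (mem-above (suc (suc (sum γ))) 1 γ (proj₁ (∷ʳ⁻ pos)) (ℕₚ.n≤1+n _)) (≡ᵇ-false (ℕₚ.<⇒≢ (ℕₚ.n<1+n (suc (sum γ))))))

    module _ (oddSum : Odd (suc (sum β))) (oddLength : Odd (suc (length β))) where

      obstruction-at : ∀ b → Odd b → b ≤ sum β →
        Obstructed (mem b 1 β) (mem (sum β ∸ b) 1 β) (mem (sum β) 1 β) (mem (1 ℕ.+ b) 1 β) (mem (1 ℕ.+ (sum β ∸ b)) 1 β) →
        ¬ PPositive (ribbon (1 ∷ β))
      obstruction-at b ob b≤ = obstruction b (sum β ∸ b) β pos oddLength ob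
        (odd-complement b (sum β ∸ b) ob (subst (λ n → Odd (suc n)) (sym (ℕₚ.m+[n∸m]≡n b≤)) oddSum))
        (sym (ℕₚ.m+[n∸m]≡n b≤))

      private
        o = leadingOnes β
        k = suc (suc o)
        k≡ : suc (headLength β) ≡ k
        k≡ = cong suc (headLength-leadingOnes β)
        mem-k : mem k 1 β ≡ false
        mem-k = trans (cong (λ n → mem (suc n) 1 β) (ℕₚ.+-comm 1 o)) (mem-after-head 1 β pos)

      -- The initial run of partial sums ends at `suc o` = k - 1, the next part jumps over k, and
      -- the last part jumps over n - 1.
      case-a : l > 1 → Even (headLength (1 ∷ β)) → ¬ PPositive (ribbon (1 ∷ β))
      case-a l>1 even = obstruction-at (suc o) (odd-pred (suc o) (subst Even k≡ even))
        (ℕₚ.<⇒≤ (leadingOnes-sum β big pos))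
        (inj₁ (trans (cong (λ n → mem n 1 β) (ℕₚ.+-comm 1 o)) (mem-head 1 β pos big) , mem-k , mem-sum-big l>1))
        where
        big : Any (2 ≤_) β
        big = ++⁺ʳ γ (here l>1)

      -- n - m is the largest proper partial sum, so neither its successor nor n - 1 belongs to S;
      -- it is odd because n is odd and m even.
      case-b : l > 1 → Even l → ¬ PPositive (ribbon (1 ∷ β))
      case-b l>1 even = obstruction-at (suc (sum γ))
        (odd-cancel-even l (suc (sum γ)) even (subst Odd (trans (cong suc (sum-∷ʳ γ l)) (ℕₚ.+-comm (suc (sum γ)) l)) oddSum))
        (subst (suc (sum γ) ≤_) (sym (sum-∷ʳ γ l)) (ℕₚ.m<m+n (sum γ) (ℕₚ.<⇒≤ l>1)))
        (inj₁ (mem-last , mem-after-last , mem-sum-big l>1))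

      -- A last part 1 puts n - 1 into S, so each of b and c needs a gap at itself or at its
      -- successor. The gaps are k, from the head, and n - k, from the tail because k = m.
      case-c : ¬ IsBasicBlock (1 ∷ β) → l ≡ 1 → headLength (1 ∷ β) ≡ headLength (reverse (1 ∷ β)) → ¬ PPositive (ribbon (1 ∷ β))
      case-c notBasic refl k≡m = [ column , go (parity k) ]′ (allOnes⊎big β pos)
        where
        column : β ≡ replicate (length β) 1 → ¬ PPositive (ribbon (1 ∷ β))
        column e = ⊥-elim (notBasic (subst (λ β → IsBasicBlock (1 ∷ β)) (sym e) (column-basic (length β))))
        mem-sum : mem (sum β) 1 β ≡ true
        mem-sum = trans (cong (λ n → mem n 1 β) (trans (sum-∷ʳ γ 1) (ℕₚ.+-comm (sum γ) 1))) mem-last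
        mem-n∸k : ∀ x → x ℕ.+ k ≡ suc (sum β) → mem x 1 β ≡ false
        mem-n∸k x e = mem-tail x 1 β pos (trans (cong (x ℕ.+_) (trans (sym k≡m) k≡)) e)
        go : Even k ⊎ Odd k → Any (2 ≤_) β → ¬ PPositive (ribbon (1 ∷ β))
        -- For b = k - 1 the gaps are 1 + b = k and c = n - k.
        go (inj₁ even) big = obstruction-at (suc o) (odd-pred (suc o) even) (ℕₚ.<⇒≤ (leadingOnes-sum β big pos))
          (inj₂ (mem-sum , inj₂ mem-k , inj₁ (mem-n∸k (sum β ∸ suc o)
            (trans (ℕₚ.+-suc (sum β ∸ suc o) (suc o)) (cong suc (ℕₚ.m∸n+n≡m (ℕₚ.<⇒≤ (leadingOnes-sum β big pos))))))))
        -- For b = k the gaps are b itself and 1 + c = n - k.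
        go (inj₂ odd) big = obstruction-at k odd (leadingOnes-sum β big pos)
          (inj₂ (mem-sum , inj₁ mem-k , inj₂ (mem-n∸k (suc (sum β ∸ k)) (cong suc (ℕₚ.m∸n+n≡m (leadingOnes-sum β big pos))))))

tailLength-big : ∀ x xs → lastOf x xs > 1 → tailLength x xs ≡ lastOf x xs
tailLength-big x xs h =
  cong (if_then headLength (reverse (x ∷ xs)) else lastOf x xs) (≡ᵇ-false (λ e → ℕₚ.<⇒≢ h (sym e)))

tailLength-one : ∀ x xs → lastOf x xs ≡ 1 → tailLength x xs ≡ headLength (reverse (x ∷ xs))
tailLength-one x xs h = cong (if_then headLength (reverse (x ∷ xs)) else lastOf x xs) (≡ᵇ-true h)

theorem4p14 : (β : List ℕ) →
    IsComposition (1 ∷ β) →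
    Odd (sum (1 ∷ β)) →
    ¬ IsBasicBlock (1 ∷ β) →
    Odd (length (1 ∷ β)) →
    ((lastOf 1 β > 1 × Even (headLength (1 ∷ β)))
    ⊎ (lastOf 1 β > 1 × Odd (headLength (1 ∷ β)) × Even (tailLength 1 β))
    ⊎ (lastOf 1 β ≡ 1 × headLength (1 ∷ β) ≡ tailLength 1 β)) →
    ¬ PPositive (ribbon (1 ∷ β))
theorem4p14 β (_ ∷ pos) oddSum notBasic oddLength = go (reverseView β) pos oddSum notBasic oddLength
  where
  go : ∀ {β} → Reverse β → All (1 ≤_) β → Odd (sum (1 ∷ β)) → ¬ IsBasicBlock (1 ∷ β) → Odd (length (1 ∷ β)) →
    ((lastOf 1 β > 1 × Even (headLength (1 ∷ β)))
    ⊎ (lastOf 1 β > 1 × Odd (headLength (1 ∷ β)) × Even (tailLength 1 β))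
    ⊎ (lastOf 1 β ≡ 1 × headLength (1 ∷ β) ≡ tailLength 1 β)) →
    ¬ PPositive (ribbon (1 ∷ β))
  -- A single box is a basic block.
  go [] _ _ notBasic _ _ _ = notBasic (column-basic 0)
  go (γ ∶ _ ∶ʳ l) pos oddSum _ oddLength (inj₁ (l>1 , even)) =
    case-a γ l pos oddSum oddLength (subst (_> 1) (lastOf-∷ʳ 1 γ l) l>1) even
  go (γ ∶ _ ∶ʳ l) pos oddSum _ oddLength (inj₂ (inj₁ (l>1 , _ , even))) =
    case-b γ l pos oddSum oddLength (subst (_> 1) (lastOf-∷ʳ 1 γ l) l>1)
      (subst Even (trans (tailLength-big 1 (γ ∷ʳ l) l>1) (lastOf-∷ʳ 1 γ l)) even)
  go (γ ∶ _ ∶ʳ l) pos oddSum notBasic oddLength (inj₂ (inj₂ (l≡1 , k≡m))) =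
    case-c γ l pos oddSum oddLength notBasic (trans (sym (lastOf-∷ʳ 1 γ l)) l≡1)
      (trans k≡m (tailLength-one 1 (γ ∷ʳ l) l≡1))
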